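{- Let $q$ be a prime power, $D\subseteq\mathbb{F}_q$ with $|D|=n$, let $\ell\ge 1$ and $k\ge 0$ be integers, let $f\in\mathcal{M}_{k+\ell}$ and let $r\ge 0$ be an integer. Then $$M(f,r)=\mathbf{1}[r\le k]\,q^{k-r}\binom{n}{r}+\frac{\mathbf{1}[k<r\le k+\ell]}{r!}\,\#\Big\{(g,(x_1,\dots,x_r)) : g\in\mathcal{M}_{k+\ell-r},\ (x_1,\dots,x_r)\in\bar X_r,\ g\prod_{j=1}^r(x+x_j)\sim f\Big\},$$ and $$N(f,r)=q^{k-r}\binom{n}{r}\sum_{j=0}^{k-r}(-q)^{ -j}\binom{n-r}{j}+\sum_{i=1}^{\ell}(-1)^{k+i-r}\binom{k+i}{r}\frac{1}{(k+i)!}\,\#\Big\{(g,(x_1,\dots,x_{k+i})) : g\in\mathcal{M}_{\ell-i},\ (x_1,\dots,x_{k+i})\in\bar X_{k+i},\ g\prod_{j=1}^{k+i}(x+x_j)\sim f\Big\}.$$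
   Context: $\mathcal{M}_d$ denotes the set of monic polynomials of degree $d$ over $\mathbb{F}_q$. For a monic $h=x^d+h_1x^{d-1}+\dots+h_d$, set $h_i=0$ for $i>d$; its $\ell$ leading coefficients are $(h_1,\dots,h_\ell)$, and $h\sim h'$ means $h,h'$ have the same $\ell$ leading coefficients. $\bar X_m$ is the set of $m$-tuples of pairwise distinct elements of $D$. For $f\in\mathcal{M}_{k+\ell}$: $M(f,r)=\sum_{S\subseteq D,|S|=r}\#\{g\in\mathcal{M}_{k+\ell}: g\sim f,\ \prod_{\alpha\in S}(x+\alpha)\mid g\}$, and $N(f,r)$ is the number of $g\in\mathcal{M}_{k+\ell}$ with $g\sim f$ such that exactly $r$ elements $\alpha\in D$ satisfy $(x+\alpha)\mid g$. $\mathbf{1}[P]$ is $1$ if $P$ holds and $0$ otherwise; binomial coefficients with out-of-range lower index are $0$, and empty sums are $0$. -}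

module Defs where

open import Data.Bool using (Bool; true; false; _∧_; if_then_else_)
open import Data.Nat as ℕ using (ℕ; zero; suc; _∸_; _!; _≤ᵇ_)
open import Data.Nat.Combinatorics using (_C_)
open import Data.Integer as ℤ using (ℤ; +_)
open import Data.Rational as ℚ using (ℚ; _/_; 0ℚ; 1ℚ)
open import Data.Fin as Fin using (Fin)
open import Data.Vec as Vec using (Vec; []; _∷_)
open import Data.List as List using (List; []; _∷_; [_])
open import Data.List.Membership.Propositional using (_∈_)
open import Data.List.Relation.Unary.Unique.Propositional using (Unique)
import Data.List.Relation.Unary.Unique.DecPropositional as UDec
open import Data.Product using (Σ; _×_; _,_)
open import Relation.Binary.PropositionalEquality using (_≡_)
open import Relation.Binary.Definitions using (DecidableEquality)
open import Relation.Nullary using (Dec; yes; no; ¬_)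
open import Relation.Nullary.Decidable using (⌊_⌋)
open import Algebra.Structures using (IsCommutativeRing)
import Data.List.Properties as LP
import Data.Vec.Properties as VP
open import Data.Nat.ListAction using (sum)
open import Data.Bool.ListAction using (any)

-- A finite field F_q: a commutative ring (with propositional equality)
-- with 0 ≠ 1 in which every nonzero element is invertible, together with
-- a duplicate-free complete enumeration of its elements.  Its order q is
-- the length of that enumeration (necessarily a prime power; conversely
-- every prime power q is the order of such a field).

record FiniteField : Set₁ where
  field
    Carrier : Set
    _+_ _*_ : Carrier → Carrier → Carrier
    -_      : Carrier → Carrier
    0# 1#   : Carrier
    isCommutativeRing : IsCommutativeRing _≡_ _+_ _*_ -_ 0# 1#
    0≢1     : ¬ (0# ≡ 1#)
    inverse : ∀ x → ¬ (x ≡ 0#) → Σ Carrier (λ y → x * y ≡ 1#)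
    _≟_     : DecidableEquality Carrier
    elements : List Carrier
    elements-unique   : Unique elements
    elements-complete : ∀ x → x ∈ elements

  order : ℕ
  order = List.length elements

allVecs : ∀ {A : Set} → List A → (m : ℕ) → List (Vec A m)
allVecs xs zero    = [ [] ]
allVecs xs (suc m) = List.concatMap (λ a → List.map (a ∷_) (allVecs xs m)) xs

count : ∀ {A : Set} → List A → (A → Bool) → ℕ
count xs p = List.length (List.filterᵇ p xs)

ι : ℕ → ℚ
ι m = + m / 1

-- 1/m for m ≥ 1 (and 0 for m = 0, never used)
inv : ℕ → ℚ
inv zero    = 0ℚ
inv (suc m) = + 1 / suc m

_^ℚ_ : ℚ → ℕ → ℚ
x ^ℚ zero  = 1ℚ
x ^ℚ suc m = x ℚ.* (x ^ℚ m)

sumℚ : List ℚ → ℚ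
sumℚ = List.foldr ℚ._+_ 0ℚ

𝟙 : ∀ {P : Set} → Dec P → ℚ
𝟙 (yes _) = 1ℚ
𝟙 (no _)  = 0ℚ

module Poly (𝔽 : FiniteField) where
  open FiniteField 𝔽

  -- a polynomial as its list of coefficients in ASCENDING order of degree
  Pol : Set
  Pol = List Carrier

  addP : Pol → Pol → Pol
  addP []       q        = q
  addP (a ∷ p)  []       = a ∷ p
  addP (a ∷ p)  (b ∷ q)  = (a + b) ∷ addP p q

  mulP : Pol → Pol → Pol
  mulP []      q = []
  mulP (a ∷ p) q = addP (List.map (a *_) q) (0# ∷ mulP p q)

  -- M_d is represented by Vec Carrier d: the vector (h₁,…,h_d) stands
  -- for the monic h = x^d + h₁ x^{d-1} + … + h_d.
  monic : ∀ {d} → Vec Carrier d → Pol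
  monic v = List.reverse (1# ∷ Vec.toList v)

  linear : Carrier → Pol
  linear α = α ∷ 1# ∷ []

  prodLin : List Carrier → Pol
  prodLin = List.foldr (λ α p → mulP (linear α) p) [ 1# ]

  -- first ℓ entries of a list, padded with zeros (h_i = 0 for i > d)
  takePad : (ℓ : ℕ) → List Carrier → Vec Carrier ℓ
  takePad zero    _        = []
  takePad (suc ℓ) []       = 0# ∷ takePad ℓ []
  takePad (suc ℓ) (a ∷ xs) = a ∷ takePad ℓ xs

  -- the ℓ leading coefficients (h₁,…,h_ℓ) of a monic polynomial
  -- (drop the leading 1 of the descending coefficient list)
  leading : (ℓ : ℕ) → Pol → Vec Carrier ℓ
  leading ℓ p = takePad ℓ (List.drop 1 (List.reverse p))

  sim : (ℓ : ℕ) → Pol → Pol → Bool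
  sim ℓ p p' = ⌊ VP.≡-dec _≟_ (leading ℓ p) (leading ℓ p') ⌋

  -- (∏_{α∈xs}(x+α)) ∣ g for monic g of degree d: there is a (necessarily
  -- monic, of degree d - |xs|) u with u · ∏(x+α) = g.  Decided by
  -- exhaustive search over M_{d-|xs|}.
  divides : List Carrier → ∀ {d} → Vec Carrier d → Bool
  divides xs {d} g =
    (List.length xs ≤ᵇ d) ∧
    any (λ u → ⌊ LP.≡-dec _≟_ (mulP (monic u) (prodLin xs)) (monic g) ⌋)
             (allVecs elements (d ∸ List.length xs))

  -- Everything below depends on D ⊆ F_q, given as an injective map
  -- D : Fin n → F_q (so |D| = n).

  module WithD {n : ℕ} (D : Fin n → Carrier) where

    subsets : List (Vec Bool n)
    subsets = allVecs (true ∷ false ∷ []) n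

    members : Vec Bool n → List Carrier
    members S = List.map D (List.filterᵇ (Vec.lookup S) (List.allFin n))

    M : (ℓ : ℕ) → ∀ {d} → Vec Carrier d → ℕ → ℕ
    M ℓ {d} f r =
      sum (List.map
        (λ S → count (allVecs elements d)
                     (λ g → sim ℓ (monic g) (monic f) ∧ divides (members S) g))
        (List.filterᵇ (λ S → ⌊ List.length (members S) ℕ.≟ r ⌋) subsets))

    nRoots : ∀ {d} → Vec Carrier d → ℕ
    nRoots g = count (List.allFin n) (λ i → divides [ D i ] g)

    N : (ℓ : ℕ) → ∀ {d} → Vec Carrier d → ℕ → ℕ
    N ℓ {d} f r =
      count (allVecs elements d)
            (λ g → sim ℓ (monic g) (monic f) ∧ ⌊ nRoots g ℕ.≟ r ⌋)

    -- X̄_m: m-tuples of pairwise distinct elements of D (D is injective,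
    -- so these are the images of m-tuples of pairwise distinct indices)
    distinctTuples : (m : ℕ) → List (Vec Carrier m)
    distinctTuples m =
      List.map (Vec.map D)
        (List.filterᵇ (λ v → ⌊ UDec.unique? Fin._≟_ (Vec.toList v) ⌋)
                      (allVecs (List.allFin n) m))

    T : (ℓ : ℕ) → ∀ {d} → Vec Carrier d → (a m : ℕ) → ℕ
    T ℓ f a m =
      sum (List.map
        (λ x → count (allVecs elements a)
                     (λ g → sim ℓ (mulP (monic g) (prodLin (Vec.toList x))) (monic f)))
        (distinctTuples m))

{-# OPTIONS --safe #-}

-- A monic multiple of ∏(x + α), α ∈ S, is ∏(x + α) times a monic cofactor u, and multiplication by a
-- linear factor acts bijectively on the ℓ leading coefficients.  Hence for r = |S| ≤ k the condition
-- g ∼ f fixes the ℓ leading coefficients of u and leaves k - r free, giving q^(k-r) multiples; for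
-- larger r the cofactors are counted as they stand, each r-subset arising from r! ordered tuples.
-- Since the x + α are pairwise coprime, ∏(x + α) divides g exactly when S consists of roots of g (up to
-- sign), so M(f, r) is the sum of binom(number of roots of g, r) over g ∼ f, and N follows by binomial
-- inversion; the terms with j ≤ k are rewritten by binom(n, j) binom(j, r) = binom(n, r) binom(n-r, j-r).

module Submission where

open import Defs
open import Algebra.Bundles using (CommutativeRing)
import Algebra.Properties.Ring as RingProperties
import Algebra.Solver.Ring.NaturalCoefficients.Default as RingSolver
open import Data.Bool as 𝔹 using (Bool; true; false; _∧_; not; if_then_else_)
open import Data.Bool.ListAction using (all)
open import Data.Bool.Properties using (T?; T-∧)
open import Data.Empty using (⊥-elim)
open import Data.Fin as Fin using (Fin; zero; suc)
import Data.Integer as ℤ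
import Data.Integer.Properties as ℤₚ
open import Data.List as List using (List; []; _∷_; [_]; _++_; length; map; reverse; foldr; filterᵇ; allFin; applyUpTo; upTo)
open import Data.List.Membership.Propositional using (_∈_; lose; find)
open import Data.List.Membership.Propositional.Properties using (∈-map⁺; ∈-map⁻; ∈-filter⁺; ∈-filter⁻; ∈-allFin; ∈-length; ∈-cartesianProductWith⁺)
open import Data.List.Membership.Propositional.Properties.WithK using (unique∧set⇒bag)
import Data.List.Membership.DecPropositional as MDec
open import Data.List.Properties as LP using (length-map; length-tabulate; map-∘; map-cong; map-++; map-tabulate; map-upTo; unfold-reverse; reverse-involutive; reverse-injective; ∷-injectiveˡ; ∷-injectiveʳ)
open import Data.List.Relation.Binary.BagAndSetEquality using (∼bag⇒↭)
open import Data.List.Relation.Binary.Permutation.Propositional as Perm using (_↭_; prep; swap; ↭-prep; ↭-sym)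
import Data.List.Relation.Binary.Permutation.Propositional.Properties as PermP
open import Data.List.Relation.Unary.All as All using (All; []; _∷_)
open import Data.List.Relation.Unary.All.Properties using (all⁻; all-filter; ¬Any⇒All¬)
open import Data.List.Relation.Unary.AllPairs using ([]; _∷_)
open import Data.List.Relation.Unary.Any using (here; there)
open import Data.List.Relation.Unary.Any.Properties using (any⁺; any⁻)
open import Data.List.Relation.Unary.Unique.Propositional using (Unique)
import Data.List.Relation.Unary.Unique.DecPropositional as UDec
import Data.List.Relation.Unary.Unique.Propositional.Properties as UP
open import Data.Nat as ℕ using (ℕ; zero; suc; _∸_; _^_; _!; _≤_; _<_; _≤?_; _<?_; z≤n; s≤s)
open import Data.Nat.Combinatorics using (_C_; nCk+nC[k+1]≡[n+1]C[k+1]; k>n⇒nCk≡0; nCk≡n!/k![n-k]!; k![n∸k]!∣n!)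
open import Data.Nat.DivMod using (m/n*n≡m)
open import Data.Nat.ListAction using (sum)
open import Data.Nat.ListAction.Properties using (sum-++)
import Data.Nat.Properties as ℕₚ
import Data.Nat.Solver as ℕ-Solver
open import Data.Product using (∃; _×_; _,_; proj₁; proj₂)
open import Data.Rational as ℚ using (ℚ; 0ℚ; 1ℚ)
import Data.Rational.Properties as ℚₚ
import Data.Rational.Solver as ℚ-Solver
open import Data.Rational.Unnormalised as ℚᵘ using (mkℚᵘ; *≡*)
import Data.Rational.Unnormalised.Properties as ℚᵘₚ
open import Data.Vec as Vec using (Vec; []; _∷_; toList; fromList; lookup; _[_]≔_)
import Data.Vec.Properties as VP
open import Function using (_∘_; id)
open import Function.Bundles using (mk⇔; Equivalence)
open import Function.Definitions using (Injective)
open import Relation.Binary.PropositionalEquality using (_≡_; refl; sym; trans; cong; cong₂; subst; module ≡-Reasoning)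
open import Relation.Nullary using (Dec; yes; no; ¬_; contradiction)
open import Relation.Nullary.Decidable using (⌊_⌋; toWitness; fromWitness)

-- No polynomial ring is built. Equality of coefficient lists is finer than equality of polynomials,
-- because trailing zeros count, and laws such as commutativity fail for `mulP` when a list is
-- empty. But every product in question is a monic polynomial times linear factors, and for these
-- one pass through the coefficients suffices: `times` works on the descending list without its
-- leading 1, and `mulP-prodLin` makes the translation once and for all. Each coefficient of the
-- product is then a coefficient of the factor plus a multiple of the preceding one, so leading
-- coefficients can be solved for from the top. Coprimality enters through evaluation at -α, where
-- every factor x + β with β ≠ α takes an invertible value. The inversion can stop at j = k + ℓ
-- because g has at most as many roots as its degree, which again follows from divisibility by the
-- product over all of them. Ordered tuples are compared with subsets by adding one index at a time;
-- the factor m + 1 counts which element of the larger subset was the added one.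

module Sums where
  open 𝔹 using (T)
  open import Data.Nat using (_+_; _*_)
  open ℕₚ
  open import Algebra.Properties.CommutativeSemigroup *-commutativeSemigroup using (x∙yz≈y∙xz)

  private
    variable
      A B X : Set

  -- Sums over lists, indicators, and enumeration of vectors.

  ∑ : List A → (A → ℕ) → ℕ
  ∑ xs F = sum (map F xs)

  ⟦_⟧ : Bool → ℕ
  ⟦ b ⟧ = if b then 1 else 0

  T-ext : ∀ {a b} → (T a → T b) → (T b → T a) → a ≡ b
  T-ext {true}  {true}  _ _ = refl
  T-ext {true}  {false} f _ = contradiction (f _) id
  T-ext {false} {true}  _ g = contradiction (g _) id
  T-ext {false} {false} _ _ = refl

  ⌊⌋-cong : ∀ {P Q : Set} (P? : Dec P) (Q? : Dec Q) → (P → Q) → (Q → P) → ⌊ P? ⌋ ≡ ⌊ Q? ⌋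
  ⌊⌋-cong _ _ f g = T-ext (fromWitness ∘ f ∘ toWitness) (fromWitness ∘ g ∘ toWitness)

  ⟦∧⟧ : ∀ a b → ⟦ a ∧ b ⟧ ≡ ⟦ a ⟧ * ⟦ b ⟧
  ⟦∧⟧ true  b = sym (+-identityʳ ⟦ b ⟧)
  ⟦∧⟧ false b = refl

  -- Sums over subsets of size r are written as sums over all subsets with an indicator; this is how
  -- the condition on the size becomes available inside such a sum.
  ⟦⌊⌋⟧*-cong : ∀ {P : Set} (P? : Dec P) {x y} → (P → x ≡ y) → ⟦ ⌊ P? ⌋ ⟧ * x ≡ ⟦ ⌊ P? ⌋ ⟧ * y
  ⟦⌊⌋⟧*-cong (yes p) eq = cong (1 *_) (eq p)
  ⟦⌊⌋⟧*-cong (no _)  eq = refl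

  ∑-cong : (xs : List A) {F G : A → ℕ} → (∀ x → F x ≡ G x) → ∑ xs F ≡ ∑ xs G
  ∑-cong xs eq = cong sum (map-cong eq xs)

  ∑-zero : (xs : List A) → ∑ xs (λ _ → 0) ≡ 0
  ∑-zero []       = refl
  ∑-zero (_ ∷ xs) = ∑-zero xs

  ∑-+ : (xs : List A) {F G : A → ℕ} → ∑ xs (λ x → F x + G x) ≡ ∑ xs F + ∑ xs G
  ∑-+ []       = refl
  ∑-+ (x ∷ xs) {F} {G} = trans (cong (F x + G x +_) (∑-+ xs))
    (solve 4 (λ a b c d → (a :+ b) :+ (c :+ d) := (a :+ c) :+ (b :+ d)) refl (F x) (G x) (∑ xs F) (∑ xs G))
    where open ℕ-Solver.+-*-Solver using (solve; _:+_; _:=_)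

  ∑-*ˡ : (xs : List A) (c : ℕ) {F : A → ℕ} → ∑ xs (λ x → c * F x) ≡ c * ∑ xs F
  ∑-*ˡ []       c = sym (*-zeroʳ c)
  ∑-*ˡ (x ∷ xs) c {F} = trans (cong (c * F x +_) (∑-*ˡ xs c)) (sym (*-distribˡ-+ c (F x) (∑ xs F)))

  ∑-*ʳ : (xs : List A) (c : ℕ) {F : A → ℕ} → ∑ xs (λ x → F x * c) ≡ ∑ xs F * c
  ∑-*ʳ xs c {F} = trans (∑-cong xs (λ x → *-comm (F x) c)) (trans (∑-*ˡ xs c) (*-comm c (∑ xs F)))

  ∑-swap : (xs : List A) (ys : List B) {F : A → B → ℕ} →
           ∑ xs (λ x → ∑ ys (F x)) ≡ ∑ ys (λ y → ∑ xs (λ x → F x y))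
  ∑-swap []       ys = sym (∑-zero ys)
  ∑-swap (x ∷ xs) ys = trans (cong (_ +_) (∑-swap xs ys)) (sym (∑-+ ys))

  ∑-filterᵇ : (p : A → Bool) (xs : List A) {F : A → ℕ} → ∑ (filterᵇ p xs) F ≡ ∑ xs (λ x → ⟦ p x ⟧ * F x)
  ∑-filterᵇ p []       = refl
  ∑-filterᵇ p (x ∷ xs) {F} with p x
  ... | true  = cong₂ _+_ (sym (+-identityʳ (F x))) (∑-filterᵇ p xs)
  ... | false = ∑-filterᵇ p xs

  ∑-map : (f : A → B) (xs : List A) {F : B → ℕ} → ∑ (map f xs) F ≡ ∑ xs (F ∘ f)
  ∑-map f xs = cong sum (sym (map-∘ xs))

  length≡∑1 : (xs : List A) → length xs ≡ ∑ xs (λ _ → 1)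
  length≡∑1 []       = refl
  length≡∑1 (_ ∷ xs) = cong suc (length≡∑1 xs)

  count≡∑ : (xs : List A) (p : A → Bool) → count xs p ≡ ∑ xs (⟦_⟧ ∘ p)
  count≡∑ xs p = trans (length≡∑1 (filterᵇ p xs)) (trans (∑-filterᵇ p xs) (∑-cong xs (λ x → *-identityʳ _)))

  count-cong : (xs : List A) {p q : A → Bool} → (∀ x → p x ≡ q x) → count xs p ≡ count xs q
  count-cong xs eq = trans (count≡∑ xs _) (trans (∑-cong xs (cong ⟦_⟧ ∘ eq)) (sym (count≡∑ xs _)))

  -- Brings the enumeration into the form to which the known facts on uniqueness and membership in
  -- cartesian products apply.
  allVecs-suc : (xs : List A) (m : ℕ) → allVecs xs (suc m) ≡ List.cartesianProductWith Vec._∷_ xs (allVecs xs m)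
  allVecs-suc {A} xs m = go xs
    where
    go : (ys : List A) → List.concatMap (λ a → map (a ∷_) (allVecs xs m)) ys
                         ≡ List.cartesianProductWith Vec._∷_ ys (allVecs xs m)
    go []       = refl
    go (y ∷ ys) = cong (map (y ∷_) (allVecs xs m) List.++_) (go ys)

  ∑-allVecs : (xs : List A) (m : ℕ) {F : Vec A (suc m) → ℕ} →
              ∑ (allVecs xs (suc m)) F ≡ ∑ xs (λ a → ∑ (allVecs xs m) (λ v → F (a ∷ v)))
  ∑-allVecs {A} xs m {F} = go xs
    where
    open ≡-Reasoning
    vs = allVecs xs m
    go : (ys : List A) → ∑ (List.concatMap (λ a → map (a ∷_) vs) ys) F ≡ ∑ ys (λ a → ∑ vs (λ v → F (a ∷ v)))
    go []       = refl
    go (y ∷ ys) = begin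
      sum (map F (map (y ∷_) vs List.++ rest))  ≡⟨ cong sum (map-++ F (map (y ∷_) vs) rest) ⟩
      sum (map F (map (y ∷_) vs) List.++ map F rest)
        ≡⟨ sum-++ (map F (map (y ∷_) vs)) (map F rest) ⟩
      ∑ (map (y ∷_) vs) F + ∑ rest F            ≡⟨ cong₂ _+_ (∑-map (y ∷_) vs) (go ys) ⟩
      ∑ vs (λ v → F (y ∷ v)) + ∑ ys (λ a → ∑ vs (λ v → F (a ∷ v))) ∎
      where rest = List.concatMap (λ a → map (a ∷_) vs) ys

  allVecs-unique : {xs : List A} → Unique xs → ∀ m → Unique (allVecs xs m)
  allVecs-unique u zero    = All.[] ∷ []
  allVecs-unique {xs = xs} u (suc m) = subst Unique (sym (allVecs-suc xs m))
    (UP.cartesianProductWith⁺ Vec._∷_ VP.∷-injective u (allVecs-unique u m))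

  allVecs-complete : {xs : List A} → (∀ x → x ∈ xs) → ∀ {m} (v : Vec A m) → v ∈ allVecs xs m
  allVecs-complete c [] = here refl
  allVecs-complete {xs = xs} c {suc m} (x ∷ v) = subst (x ∷ v ∈_) (sym (allVecs-suc xs m))
    (∈-cartesianProductWith⁺ Vec._∷_ (c x) (allVecs-complete c v))

  length-allVecs : (xs : List A) (m : ℕ) → length (allVecs xs m) ≡ length xs ^ m
  length-allVecs xs zero    = refl
  length-allVecs xs (suc m) = begin
    length (allVecs xs (suc m))               ≡⟨ length≡∑1 (allVecs xs (suc m)) ⟩
    ∑ (allVecs xs (suc m)) (λ _ → 1)          ≡⟨ ∑-allVecs xs m ⟩
    ∑ xs (λ _ → ∑ (allVecs xs m) (λ _ → 1))
      ≡⟨ ∑-cong xs (λ _ → trans (sym (length≡∑1 (allVecs xs m))) (trans (length-allVecs xs m) (sym (*-identityˡ (length xs ^ m))))) ⟩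
    ∑ xs (λ _ → 1 * length xs ^ m)            ≡⟨ ∑-*ʳ xs (length xs ^ m) ⟩
    ∑ xs (λ _ → 1) * length xs ^ m            ≡⟨ cong (_* length xs ^ m) (sym (length≡∑1 xs)) ⟩
    length xs * length xs ^ m                 ∎
    where open ≡-Reasoning

  count-true : (xs : List A) → count xs (λ _ → true) ≡ length xs
  count-true xs = trans (count≡∑ xs (λ _ → true)) (sym (length≡∑1 xs))

  unique-set⇒↭ : {xs ys : List A} → Unique xs → Unique ys →
                 (∀ {x} → x ∈ xs → x ∈ ys) → (∀ {x} → x ∈ ys → x ∈ xs) → xs ↭ ys
  unique-set⇒↭ u v f g = ∼bag⇒↭ (unique∧set⇒bag u v (mk⇔ f g))

  -- A bijection between {x | p x} and {y | q y} presented by embeddings of both into a common type.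
  count-bijection : {xs : List A} {ys : List B} {p : A → Bool} {q : B → Bool} →
    Unique xs → Unique ys → (∀ x → x ∈ xs) → (∀ y → y ∈ ys) →
    (f : A → X) (g : B → X) →
    (∀ {x x′} → f x ≡ f x′ → x ≡ x′) → (∀ {y y′} → g y ≡ g y′ → y ≡ y′) →
    (∀ x → T (p x) → ∃ λ y → T (q y) × f x ≡ g y) →
    (∀ y → T (q y) → ∃ λ x → T (p x) × f x ≡ g y) →
    count xs p ≡ count ys q
  count-bijection {xs = xs} {ys} {p} {q} ux uy cx cy f g f-inj g-inj to from = begin
    length (filterᵇ p xs)          ≡⟨ length-map f (filterᵇ p xs) ⟨
    length (map f (filterᵇ p xs))  ≡⟨ PermP.↭-length (unique-set⇒↭ (UP.map⁺ f-inj (UP.filter⁺ (T? ∘ p) ux)) (UP.map⁺ g-inj (UP.filter⁺ (T? ∘ q) uy)) fwd bwd) ⟩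
    length (map g (filterᵇ q ys))  ≡⟨ length-map g (filterᵇ q ys) ⟩
    length (filterᵇ q ys)          ∎
    where
    open ≡-Reasoning
    fwd : ∀ {z} → z ∈ map f (filterᵇ p xs) → z ∈ map g (filterᵇ q ys)
    fwd z∈ with x , x∈ , refl ← ∈-map⁻ f z∈
           with y , qy , eq ← to x (proj₂ (∈-filter⁻ (T? ∘ p) {xs = xs} x∈))
           = subst (_∈ map g (filterᵇ q ys)) (sym eq) (∈-map⁺ g (∈-filter⁺ (T? ∘ q) (cy y) qy))
    bwd : ∀ {z} → z ∈ map g (filterᵇ q ys) → z ∈ map f (filterᵇ p xs)
    bwd z∈ with y , y∈ , refl ← ∈-map⁻ g z∈
           with x , px , eq ← from y (proj₂ (∈-filter⁻ (T? ∘ q) {xs = ys} y∈))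
           = subst (_∈ map f (filterᵇ p xs)) eq (∈-map⁺ f (∈-filter⁺ (T? ∘ p) (cx x) px))

  -- Subsets of Fin n

  𝒫 : (n : ℕ) → List (Vec Bool n)
  𝒫 n = allVecs (true ∷ false ∷ []) n

  indices : ∀ {n} → Vec Bool n → List (Fin n)
  indices S = filterᵇ (lookup S) (allFin _)

  ∑-𝒫-suc : ∀ n {F : Vec Bool (suc n) → ℕ} →
            ∑ (𝒫 (suc n)) F ≡ ∑ (𝒫 n) (λ S → F (true ∷ S)) + ∑ (𝒫 n) (λ S → F (false ∷ S))
  ∑-𝒫-suc n {F} = trans (∑-allVecs (true ∷ false ∷ []) n) (cong (∑ (𝒫 n) (λ S → F (true ∷ S)) +_) (+-identityʳ _))

  filterᵇ-map : (f : A → B) (p : B → Bool) (xs : List A) → filterᵇ p (map f xs) ≡ map f (filterᵇ (p ∘ f) xs)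
  filterᵇ-map f p []       = refl
  filterᵇ-map f p (x ∷ xs) with p (f x)
  ... | true  = cong (f x ∷_) (filterᵇ-map f p xs)
  ... | false = filterᵇ-map f p xs

  filterᵇ-allFin-suc : ∀ n (p : Fin (suc n) → Bool) →
    filterᵇ p (List.tabulate suc) ≡ map suc (filterᵇ (p ∘ suc) (allFin n))
  filterᵇ-allFin-suc n p = trans (cong (filterᵇ p) (sym (map-tabulate id suc))) (filterᵇ-map suc p (allFin n))

  indices-true : ∀ {n} (S : Vec Bool n) → indices (true ∷ S) ≡ zero ∷ map suc (indices S)
  indices-true S = cong (zero ∷_) (filterᵇ-allFin-suc _ (lookup (true ∷ S)))

  indices-false : ∀ {n} (S : Vec Bool n) → indices (false ∷ S) ≡ map suc (indices S)
  indices-false S = filterᵇ-allFin-suc _ (lookup (false ∷ S))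

  indices-unique : ∀ {n} (S : Vec Bool n) → Unique (indices S)
  indices-unique S = UP.filter⁺ (T? ∘ lookup S) (UP.allFin⁺ _)

  ∈-indices⁺ : ∀ {n} (S : Vec Bool n) {i} → T (lookup S i) → i ∈ indices S
  ∈-indices⁺ S = ∈-filter⁺ (T? ∘ lookup S) (∈-allFin _)

  ∈-indices⁻ : ∀ {n} (S : Vec Bool n) {i} → i ∈ indices S → T (lookup S i)
  ∈-indices⁻ S i∈ = proj₂ (∈-filter⁻ (T? ∘ lookup S) {xs = allFin _} i∈)

  count-allFin-suc : ∀ n (R : Fin (suc n) → Bool) → count (allFin (suc n)) R ≡ ⟦ R zero ⟧ + count (allFin n) (R ∘ suc)
  count-allFin-suc n R with R zero
  ... | true  = cong suc (trans (cong length (filterᵇ-allFin-suc n R)) (length-map suc (filterᵇ (R ∘ suc) (allFin n))))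
  ... | false = trans (cong length (filterᵇ-allFin-suc n R)) (length-map suc (filterᵇ (R ∘ suc) (allFin n)))

  all-map : (p : B → Bool) (f : A → B) (xs : List A) → all p (map f xs) ≡ all (p ∘ f) xs
  all-map p f []       = refl
  all-map p f (x ∷ xs) = cong (p (f x) ∧_) (all-map p f xs)

  -- Induction on `n`, splitting by whether the subset contains 0. If `R zero` fails, the subsets
  -- containing 0 contribute nothing; otherwise the two halves are the two terms of Pascal's rule.
  ∑-subsets-of : ∀ {n} (R : Fin n → Bool) (r : ℕ) →
    ∑ (𝒫 n) (λ S → ⟦ ⌊ length (indices S) ℕ.≟ r ⌋ ⟧ * ⟦ all R (indices S) ⟧) ≡ count (allFin n) R C r
  ∑-subsets-of {zero}  R zero    = refl
  ∑-subsets-of {zero}  R (suc r) = refl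
  ∑-subsets-of {suc n} R r = begin
    ∑ (𝒫 (suc n)) F                                                 ≡⟨ ∑-𝒫-suc n ⟩
    ∑ (𝒫 n) (λ S → F (true ∷ S)) + ∑ (𝒫 n) (λ S → F (false ∷ S))
      ≡⟨ cong₂ _+_ (∑-cong (𝒫 n) with0) (trans (∑-cong (𝒫 n) without0) (∑-subsets-of (R ∘ suc) r)) ⟩
    ∑ (𝒫 n) (λ S → ⟦ ⌊ suc (length (indices S)) ℕ.≟ r ⌋ ⟧ * ⟦ R zero ∧ all (R ∘ suc) (indices S) ⟧) + c C r
      ≡⟨ pascal r (R zero) ⟩
    (⟦ R zero ⟧ + c) C r                                            ≡⟨ cong (_C r) (count-allFin-suc n R) ⟨
    count (allFin (suc n)) R C r                                    ∎
    where
    open ≡-Reasoning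
    c = count (allFin n) (R ∘ suc)
    weight : List (Fin (suc n)) → ℕ
    weight is = ⟦ ⌊ length is ℕ.≟ r ⌋ ⟧ * ⟦ all R is ⟧
    F : Vec Bool (suc n) → ℕ
    F S = weight (indices S)
    with0 : ∀ S → F (true ∷ S) ≡ ⟦ ⌊ suc (length (indices S)) ℕ.≟ r ⌋ ⟧ * ⟦ R zero ∧ all (R ∘ suc) (indices S) ⟧
    with0 S = trans (cong weight (indices-true S))
      (cong₂ (λ l b → ⟦ ⌊ suc l ℕ.≟ r ⌋ ⟧ * ⟦ R zero ∧ b ⟧) (length-map suc (indices S)) (all-map R suc (indices S)))
    without0 : ∀ S → F (false ∷ S) ≡ ⟦ ⌊ length (indices S) ℕ.≟ r ⌋ ⟧ * ⟦ all (R ∘ suc) (indices S) ⟧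
    without0 S = trans (cong weight (indices-false S))
      (cong₂ (λ l b → ⟦ ⌊ l ℕ.≟ r ⌋ ⟧ * ⟦ b ⟧) (length-map suc (indices S)) (all-map R suc (indices S)))
    pascal : ∀ r b → ∑ (𝒫 n) (λ S → ⟦ ⌊ suc (length (indices S)) ℕ.≟ r ⌋ ⟧ * ⟦ b ∧ all (R ∘ suc) (indices S) ⟧) + c C r
                     ≡ (⟦ b ⟧ + c) C r
    pascal r false = cong (_+ c C r) (trans (∑-cong (𝒫 n) (λ S → *-zeroʳ ⟦ ⌊ suc (length (indices S)) ℕ.≟ r ⌋ ⟧)) (∑-zero (𝒫 n)))
    pascal zero true = cong (_+ c C 0) (∑-zero (𝒫 n))
    pascal (suc r) true = trans (cong (_+ c C suc r) (trans
        (∑-cong (𝒫 n) (λ S → cong (λ b → ⟦ b ⟧ * ⟦ all (R ∘ suc) (indices S) ⟧)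
                               (⌊⌋-cong (suc (length (indices S)) ℕ.≟ suc r) (length (indices S) ℕ.≟ r) suc-injective (cong suc))))
        (∑-subsets-of (R ∘ suc) r)))
      (nCk+nC[k+1]≡[n+1]C[k+1] c r)

  all-true : (xs : List A) → all (λ _ → true) xs ≡ true
  all-true []       = refl
  all-true (_ ∷ xs) = all-true xs

  ∑-subsets-of-size : ∀ n r → ∑ (𝒫 n) (λ S → ⟦ ⌊ length (indices S) ℕ.≟ r ⌋ ⟧) ≡ n C r
  ∑-subsets-of-size n r = begin
    ∑ (𝒫 n) (λ S → ⟦ ⌊ length (indices S) ℕ.≟ r ⌋ ⟧)
      ≡⟨ ∑-cong (𝒫 n) (λ S → sym (trans (cong (λ b → ⟦ ⌊ length (indices S) ℕ.≟ r ⌋ ⟧ * ⟦ b ⟧) (all-true (indices S))) (*-identityʳ _))) ⟩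
    ∑ (𝒫 n) (λ S → ⟦ ⌊ length (indices S) ℕ.≟ r ⌋ ⟧ * ⟦ all (λ _ → true) (indices S) ⟧)
      ≡⟨ ∑-subsets-of {n} (λ _ → true) r ⟩
    count (allFin n) (λ _ → true) C r
      ≡⟨ cong (_C r) (trans (count-true (allFin n)) (length-tabulate {n = n} id)) ⟩
    n C r ∎
    where open ≡-Reasoning

  -- Adding `i` is a bijection from the subsets without `i` to those with `i`. At position 0 the two
  -- halves of the enumeration merely change places.
  ∑-insert : ∀ {n} (i : Fin n) (H : Vec Bool n → ℕ) →
    ∑ (𝒫 n) (λ S → ⟦ not (lookup S i) ⟧ * H (S [ i ]≔ true)) ≡ ∑ (𝒫 n) (λ S → ⟦ lookup S i ⟧ * H S)
  ∑-insert {suc n} zero H = begin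
    _ ≡⟨ ∑-𝒫-suc n ⟩
    ∑ (𝒫 n) (λ _ → 0) + ∑ (𝒫 n) (λ S → 1 * H (true ∷ S)) ≡⟨ +-comm (∑ (𝒫 n) (λ _ → 0)) _ ⟩
    ∑ (𝒫 n) (λ S → 1 * H (true ∷ S)) + ∑ (𝒫 n) (λ _ → 0) ≡⟨ ∑-𝒫-suc n ⟨
    _ ∎
    where open ≡-Reasoning
  ∑-insert {suc n} (suc i) H =
    trans (∑-𝒫-suc n) (trans (cong₂ _+_ (∑-insert i (λ S → H (true ∷ S))) (∑-insert i (λ S → H (false ∷ S)))) (sym (∑-𝒫-suc n)))

  -- Only a permutation, since `indices` lists in increasing order and the new index need not come
  -- first. This is why the summands below must be invariant under permutation.
  indices-insert : ∀ {n} (S : Vec Bool n) (i : Fin n) → lookup S i ≡ false → indices (S [ i ]≔ true) ↭ i ∷ indices S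
  indices-insert S i Sᵢ = unique-set⇒↭ (indices-unique (S [ i ]≔ true))
    (¬Any⇒All¬ (indices S) (λ i∈ → subst T Sᵢ (∈-indices⁻ S i∈)) ∷ indices-unique S) to from
    where
    to : ∀ {j} → j ∈ indices (S [ i ]≔ true) → j ∈ i ∷ indices S
    to {j} j∈ with j Fin.≟ i
    ... | yes refl = here refl
    ... | no  j≢i  = there (∈-indices⁺ S (subst T (VP.lookup∘update′ j≢i S true) (∈-indices⁻ (S [ i ]≔ true) j∈)))
    from : ∀ {j} → j ∈ i ∷ indices S → j ∈ indices (S [ i ]≔ true)
    from (here refl) = ∈-indices⁺ (S [ i ]≔ true) (subst T (sym (VP.lookup∘update i S true)) _)
    from {j} (there j∈) with j Fin.≟ i
    ... | yes refl = ∈-indices⁺ (S [ i ]≔ true) (subst T (sym (VP.lookup∘update i S true)) _)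
    ... | no  j≢i  = ∈-indices⁺ (S [ i ]≔ true) (subst T (sym (VP.lookup∘update′ j≢i S true)) (∈-indices⁻ S j∈))

  -- Tuples of distinct indices against subsets.

  module _ {n : ℕ} where
    open UDec (Fin._≟_ {n}) using (unique?)
    open MDec (Fin._≟_ {n}) using (_∈?_)

    private
      avoids : Fin n → List (Fin n) → Bool
      avoids i v = not ⌊ i ∈? v ⌋

    unique?-∷ : ∀ i v → ⟦ ⌊ unique? (i ∷ v) ⌋ ⟧ ≡ ⟦ ⌊ unique? v ⌋ ⟧ * ⟦ avoids i v ⟧
    unique?-∷ i v with i ∈? v | unique? v | unique? (i ∷ v)
    ... | yes i∈ | _      | yes u       = contradiction i∈ (UP.Unique[x∷xs]⇒x∉xs u)
    ... | yes i∈ | yes _  | no _        = refl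
    ... | yes i∈ | no _   | no _        = refl
    ... | no _   | yes _  | yes _       = refl
    ... | no i∉  | yes u  | no ¬u       = contradiction (¬Any⇒All¬ v i∉ ∷ u) ¬u
    ... | no _   | no ¬u  | yes (_ ∷ u) = contradiction u ¬u
    ... | no _   | no _   | no _        = refl

    avoids-↭ : ∀ i {v w} → v ↭ w → avoids i v ≡ avoids i w
    avoids-↭ i {v} {w} v↭w = cong not (⌊⌋-cong (i ∈? v) (i ∈? w) (PermP.∈-resp-↭ v↭w) (PermP.∈-resp-↭ (↭-sym v↭w)))

    avoids-indices : ∀ i S → avoids i (indices S) ≡ not (lookup S i)
    avoids-indices i S = cong not (T-ext (∈-indices⁻ S ∘ toWitness) (fromWitness ∘ ∈-indices⁺ S))

    -- The pairs (S, i) with i ∉ S and |S| = m correspond to the pairs (S′, i) with i ∈ S′ and |S′| = m + 1.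
    ∑-insertions : (G : List (Fin n) → ℕ) → (∀ {v w} → v ↭ w → G v ≡ G w) → ∀ m →
      ∑ (𝒫 n) (λ S → ⟦ ⌊ length (indices S) ℕ.≟ m ⌋ ⟧ * ∑ (allFin n) (λ i → ⟦ avoids i (indices S) ⟧ * G (i ∷ indices S)))
      ≡ suc m * ∑ (𝒫 n) (λ S → ⟦ ⌊ length (indices S) ℕ.≟ suc m ⌋ ⟧ * G (indices S))
    ∑-insertions G G-↭ m = begin
      ∑ (𝒫 n) (λ S → ⟦ ⌊ length (indices S) ℕ.≟ m ⌋ ⟧ * ∑ (allFin n) (λ i → ⟦ avoids i (indices S) ⟧ * G (i ∷ indices S)))
        ≡⟨ ∑-cong (𝒫 n) (λ S → sym (∑-*ˡ (allFin n) ⟦ ⌊ length (indices S) ℕ.≟ m ⌋ ⟧)) ⟩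
      ∑ (𝒫 n) (λ S → ∑ (allFin n) (λ i → ⟦ ⌊ length (indices S) ℕ.≟ m ⌋ ⟧ * (⟦ avoids i (indices S) ⟧ * G (i ∷ indices S))))
        ≡⟨ ∑-swap (𝒫 n) (allFin n) ⟩
      ∑ (allFin n) (λ i → ∑ (𝒫 n) (λ S → ⟦ ⌊ length (indices S) ℕ.≟ m ⌋ ⟧ * (⟦ avoids i (indices S) ⟧ * G (i ∷ indices S))))
        ≡⟨ ∑-cong (allFin n) (λ i → trans (∑-cong (𝒫 n) (insert i)) (∑-insert i H)) ⟩
      ∑ (allFin n) (λ i → ∑ (𝒫 n) (λ S → ⟦ lookup S i ⟧ * H S))
        ≡⟨ ∑-swap (allFin n) (𝒫 n) ⟩
      ∑ (𝒫 n) (λ S → ∑ (allFin n) (λ i → ⟦ lookup S i ⟧ * H S))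
        ≡⟨ ∑-cong (𝒫 n) size ⟩
      ∑ (𝒫 n) (λ S → suc m * H S)
        ≡⟨ ∑-*ˡ (𝒫 n) (suc m) ⟩
      suc m * ∑ (𝒫 n) H ∎
      where
      open ≡-Reasoning
      H : Vec Bool n → ℕ
      H S = ⟦ ⌊ length (indices S) ℕ.≟ suc m ⌋ ⟧ * G (indices S)

      insert : ∀ i S → ⟦ ⌊ length (indices S) ℕ.≟ m ⌋ ⟧ * (⟦ avoids i (indices S) ⟧ * G (i ∷ indices S))
                       ≡ ⟦ not (lookup S i) ⟧ * H (S [ i ]≔ true)
      insert i S rewrite avoids-indices i S with lookup S i in Sᵢ
      ... | true  = *-zeroʳ ⟦ ⌊ length (indices S) ℕ.≟ m ⌋ ⟧
      ... | false = trans (cong₂ (λ b x → ⟦ b ⟧ * (1 * x))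
                                 (⌊⌋-cong (length (indices S) ℕ.≟ m) (length (indices (S [ i ]≔ true)) ℕ.≟ suc m)
                                          (trans eq ∘ cong suc) (suc-injective ∘ trans (sym eq)))
                                 (G-↭ (↭-sym S′↭)))
                          (x∙yz≈y∙xz ⟦ ⌊ length (indices (S [ i ]≔ true)) ℕ.≟ suc m ⌋ ⟧ 1 _)
        where
        S′↭ = indices-insert S i Sᵢ
        eq : length (indices (S [ i ]≔ true)) ≡ suc (length (indices S))
        eq = PermP.↭-length S′↭

      size : ∀ S → ∑ (allFin n) (λ i → ⟦ lookup S i ⟧ * H S) ≡ suc m * H S
      size S = begin
        ∑ (allFin n) (λ i → ⟦ lookup S i ⟧ * H S)  ≡⟨ ∑-*ʳ (allFin n) (H S) ⟩
        ∑ (allFin n) (λ i → ⟦ lookup S i ⟧) * H S  ≡⟨ cong (_* H S) (count≡∑ (allFin n) (lookup S)) ⟨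
        length (indices S) * H S                   ≡⟨ x∙yz≈y∙xz (length (indices S)) ⟦ ⌊ length (indices S) ℕ.≟ suc m ⌋ ⟧ _ ⟩
        ⟦ ⌊ length (indices S) ℕ.≟ suc m ⌋ ⟧ * (length (indices S) * G (indices S))
          ≡⟨ ⟦⌊⌋⟧*-cong (length (indices S) ℕ.≟ suc m) (cong (_* G (indices S))) ⟩
        ⟦ ⌊ length (indices S) ℕ.≟ suc m ⌋ ⟧ * (suc m * G (indices S))
          ≡⟨ x∙yz≈y∙xz ⟦ ⌊ length (indices S) ℕ.≟ suc m ⌋ ⟧ (suc m) _ ⟩
        suc m * H S ∎

    -- Induction on the length of the tuple, for all invariant `G` at once. Summing over the
    -- admissible heads turns `G` into a function `G′` of the tail that is invariant again, so the
    -- induction hypothesis applies to `G′`, and `∑-insertions` supplies the new factor of the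
    -- factorial.
    ∑-distinct-tuples : (G : List (Fin n) → ℕ) → (∀ {v w} → v ↭ w → G v ≡ G w) → ∀ m →
      ∑ (allVecs (allFin n) m) (λ v → ⟦ ⌊ unique? (toList v) ⌋ ⟧ * G (toList v))
      ≡ m ! * ∑ (𝒫 n) (λ S → ⟦ ⌊ length (indices S) ℕ.≟ m ⌋ ⟧ * G (indices S))
    ∑-distinct-tuples G G-↭ zero = begin
      1 * G [] + 0                                                   ≡⟨ +-identityʳ _ ⟩
      1 * G []                                                       ≡⟨ cong (_* G []) (∑-subsets-of-size n 0) ⟨
      ∑ (𝒫 n) (λ S → ⟦ ⌊ length (indices S) ℕ.≟ 0 ⌋ ⟧) * G []        ≡⟨ ∑-*ʳ (𝒫 n) (G []) ⟨
      ∑ (𝒫 n) (λ S → ⟦ ⌊ length (indices S) ℕ.≟ 0 ⌋ ⟧ * G [])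
        ≡⟨ ∑-cong (𝒫 n) (λ S → ⟦⌊⌋⟧*-cong (length (indices S) ℕ.≟ 0) (λ eq → cong G (sym (length-zero eq)))) ⟩
      ∑ (𝒫 n) (λ S → ⟦ ⌊ length (indices S) ℕ.≟ 0 ⌋ ⟧ * G (indices S)) ≡⟨ *-identityˡ _ ⟨
      1 * ∑ (𝒫 n) (λ S → ⟦ ⌊ length (indices S) ℕ.≟ 0 ⌋ ⟧ * G (indices S)) ∎
      where
      open ≡-Reasoning
      length-zero : {xs : List (Fin n)} → length xs ≡ 0 → xs ≡ []
      length-zero {[]} _ = refl
    ∑-distinct-tuples G G-↭ (suc m) = begin
      ∑ (allVecs (allFin n) (suc m)) (λ v → ⟦ ⌊ unique? (toList v) ⌋ ⟧ * G (toList v))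
        ≡⟨ ∑-allVecs (allFin n) m ⟩
      ∑ (allFin n) (λ i → ∑ Vs (λ v → ⟦ ⌊ unique? (i ∷ toList v) ⌋ ⟧ * G (i ∷ toList v)))
        ≡⟨ ∑-swap (allFin n) Vs ⟩
      ∑ Vs (λ v → ∑ (allFin n) (λ i → ⟦ ⌊ unique? (i ∷ toList v) ⌋ ⟧ * G (i ∷ toList v)))
        ≡⟨ ∑-cong Vs (λ v → trans (∑-cong (allFin n) (λ i → trans (cong (_* G (i ∷ toList v)) (unique?-∷ i (toList v)))
                                                                  (*-assoc ⟦ ⌊ unique? (toList v) ⌋ ⟧ _ _)))
                                  (∑-*ˡ (allFin n) ⟦ ⌊ unique? (toList v) ⌋ ⟧)) ⟩
      ∑ Vs (λ v → ⟦ ⌊ unique? (toList v) ⌋ ⟧ * G′ (toList v))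
        ≡⟨ ∑-distinct-tuples G′ G′-↭ m ⟩
      m ! * ∑ (𝒫 n) (λ S → ⟦ ⌊ length (indices S) ℕ.≟ m ⌋ ⟧ * G′ (indices S))
        ≡⟨ cong (m ! *_) (∑-insertions G G-↭ m) ⟩
      m ! * (suc m * ∑ (𝒫 n) (λ S → ⟦ ⌊ length (indices S) ℕ.≟ suc m ⌋ ⟧ * G (indices S)))
        ≡⟨ *-assoc (m !) (suc m) _ ⟨
      m ! * suc m * ∑ (𝒫 n) (λ S → ⟦ ⌊ length (indices S) ℕ.≟ suc m ⌋ ⟧ * G (indices S))
        ≡⟨ cong (_* ∑ (𝒫 n) (λ S → ⟦ ⌊ length (indices S) ℕ.≟ suc m ⌋ ⟧ * G (indices S))) (*-comm (m !) (suc m)) ⟩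
      suc m ! * ∑ (𝒫 n) (λ S → ⟦ ⌊ length (indices S) ℕ.≟ suc m ⌋ ⟧ * G (indices S)) ∎
      where
      open ≡-Reasoning
      Vs = allVecs (allFin n) m
      G′ : List (Fin n) → ℕ
      G′ v = ∑ (allFin n) (λ i → ⟦ avoids i v ⟧ * G (i ∷ v))
      G′-↭ : ∀ {v w} → v ↭ w → G′ v ≡ G′ w
      G′-↭ v↭w = ∑-cong (allFin n) (λ i → cong₂ (λ b x → ⟦ b ⟧ * x) (avoids-↭ i v↭w) (G-↭ (↭-prep i v↭w)))

open Sums

-- Rational sums and binomial inversion.

module Inversion where
  open import Data.Integer using (+_)
  open import Data.Rational using (_+_; _*_; -_; toℚᵘ)
  open ℚₚ
  open ℚ-Solver.+-*-Solver using (solve; _:+_; _:*_; _:=_; :-_; con)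

  -- Fractions in `ℚ` are reduced by a gcd, which is stuck on variables; among unnormalised
  -- fractions the claim is an identity of integers.
  ι-+ : ∀ a b → ι (a ℕ.+ b) ≡ ι a + ι b
  ι-+ a b = toℚᵘ-injective (begin-equality
    toℚᵘ (ι (a ℕ.+ b))                ≃⟨ toℚᵘ-fromℚᵘ (mkℚᵘ (+ (a ℕ.+ b)) 0) ⟩
    mkℚᵘ (+ (a ℕ.+ b)) 0              ≃⟨ *≡* (cong (ℤ._* + 1) (sym (cong₂ ℤ._+_ (ℤₚ.*-identityʳ (+ a)) (ℤₚ.*-identityʳ (+ b))))) ⟩
    mkℚᵘ (+ a) 0 ℚᵘ.+ mkℚᵘ (+ b) 0    ≃⟨ ℚᵘₚ.+-cong (toℚᵘ-fromℚᵘ (mkℚᵘ (+ a) 0)) (toℚᵘ-fromℚᵘ (mkℚᵘ (+ b) 0)) ⟨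
    toℚᵘ (ι a) ℚᵘ.+ toℚᵘ (ι b)        ≃⟨ toℚᵘ-homo-+ (ι a) (ι b) ⟨
    toℚᵘ (ι a + ι b)                  ∎)
    where open ℚᵘₚ.≤-Reasoning

  ι-* : ∀ a b → ι (a ℕ.* b) ≡ ι a * ι b
  ι-* a b = toℚᵘ-injective (begin-equality
    toℚᵘ (ι (a ℕ.* b))                ≃⟨ toℚᵘ-fromℚᵘ (mkℚᵘ (+ (a ℕ.* b)) 0) ⟩
    mkℚᵘ (+ (a ℕ.* b)) 0              ≃⟨ *≡* (cong (ℤ._* + 1) (ℤₚ.pos-* a b)) ⟩
    mkℚᵘ (+ a) 0 ℚᵘ.* mkℚᵘ (+ b) 0    ≃⟨ ℚᵘₚ.*-cong (toℚᵘ-fromℚᵘ (mkℚᵘ (+ a) 0)) (toℚᵘ-fromℚᵘ (mkℚᵘ (+ b) 0)) ⟨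
    toℚᵘ (ι a) ℚᵘ.* toℚᵘ (ι b)        ≃⟨ toℚᵘ-homo-* (ι a) (ι b) ⟨
    toℚᵘ (ι a * ι b)                  ∎)
    where open ℚᵘₚ.≤-Reasoning

  ι-^ : ∀ a e → ι (a ^ e) ≡ ι a ^ℚ e
  ι-^ a zero    = refl
  ι-^ a (suc e) = trans (ι-* a (a ^ e)) (cong (ι a *_) (ι-^ a e))

  inv-*-ι : ∀ m .{{_ : ℕ.NonZero m}} → inv m * ι m ≡ 1ℚ
  inv-*-ι (suc m) = toℚᵘ-injective (begin-equality
    toℚᵘ (inv (suc m) * ι (suc m))             ≃⟨ toℚᵘ-homo-* (inv (suc m)) (ι (suc m)) ⟩
    toℚᵘ (inv (suc m)) ℚᵘ.* toℚᵘ (ι (suc m))   ≃⟨ ℚᵘₚ.*-cong (toℚᵘ-fromℚᵘ (mkℚᵘ (+ 1) m)) (toℚᵘ-fromℚᵘ (mkℚᵘ (+ suc m) 0)) ⟩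
    mkℚᵘ (+ 1) m ℚᵘ.* mkℚᵘ (+ suc m) 0         ≃⟨ *≡* (trans (ℤₚ.*-identityʳ _) (cong (λ x → + 1 ℤ.* + x) (sym (ℕₚ.*-identityʳ (suc m))))) ⟩
    mkℚᵘ (+ 1) 0                               ∎)
    where open ℚᵘₚ.≤-Reasoning

  -- With `applyUpTo` the first term splits off by computation and leaves the sum of `f ∘ suc`, so
  -- the inductions below need no reindexing.
  sumTo : (ℕ → ℚ) → ℕ → ℚ
  sumTo f m = sumℚ (applyUpTo f m)

  sumTo-cong : ∀ {f g : ℕ → ℚ} m → (∀ i → i < m → f i ≡ g i) → sumTo f m ≡ sumTo g m
  sumTo-cong zero    eq = refl
  sumTo-cong (suc m) eq = cong₂ _+_ (eq 0 (s≤s z≤n)) (sumTo-cong m (λ i i<m → eq (suc i) (s≤s i<m)))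

  sumTo-zero : ∀ m → sumTo (λ _ → 0ℚ) m ≡ 0ℚ
  sumTo-zero zero    = refl
  sumTo-zero (suc m) = trans (+-identityˡ _) (sumTo-zero m)

  sumTo-+ : ∀ (f g : ℕ → ℚ) m → sumTo (λ i → f i + g i) m ≡ sumTo f m + sumTo g m
  sumTo-+ f g zero    = refl
  sumTo-+ f g (suc m) = trans (cong (_+_ (f 0 + g 0)) (sumTo-+ (f ∘ suc) (g ∘ suc) m))
    (solve 4 (λ a b c d → (a :+ b) :+ (c :+ d) := (a :+ c) :+ (b :+ d)) refl (f 0) (g 0) (sumTo (f ∘ suc) m) (sumTo (g ∘ suc) m))

  sumTo-* : ∀ c (f : ℕ → ℚ) m → sumTo (λ i → c * f i) m ≡ c * sumTo f m
  sumTo-* c f zero    = sym (*-zeroʳ c)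
  sumTo-* c f (suc m) = trans (cong (_+_ (c * f 0)) (sumTo-* c (f ∘ suc) m)) (sym (*-distribˡ-+ c (f 0) _))

  sumTo-neg : ∀ (f : ℕ → ℚ) m → sumTo (λ i → - f i) m ≡ - sumTo f m
  sumTo-neg f zero    = refl
  sumTo-neg f (suc m) = trans (cong (_+_ (- f 0)) (sumTo-neg (f ∘ suc) m)) (sym (neg-distrib-+ (f 0) _))

  sumTo-split : ∀ (f : ℕ → ℚ) a b → sumTo f (a ℕ.+ b) ≡ sumTo f a + sumTo (λ i → f (a ℕ.+ i)) b
  sumTo-split f zero    b = sym (+-identityˡ _)
  sumTo-split f (suc a) b = trans (cong (_+_ (f 0)) (sumTo-split (f ∘ suc) a b)) (sym (+-assoc (f 0) _ _))

  -- The entries of the inverse of Pascal's matrix. Truncation of j - r is harmless, as the binomial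
  -- coefficient vanishes for j < r.
  signedC : ℕ → ℕ → ℚ
  signedC j r = (- ι 1) ^ℚ (j ∸ r) * ι (j C r)

  signedC-< : ∀ {j r} → j < r → signedC j r ≡ 0ℚ
  signedC-< {j} {r} j<r = trans (cong (λ c → (- ι 1) ^ℚ (j ∸ r) * ι c) (k>n⇒nCk≡0 j<r)) (*-zeroʳ ((- ι 1) ^ℚ (j ∸ r)))

  signedC-suc-zero : ∀ j → signedC (suc j) 0 ≡ - signedC j 0
  signedC-suc-zero j = solve 2 (λ p c → :- con 1ℚ :* p :* c := :- (p :* c)) refl ((- ι 1) ^ℚ j) (ι 1)

  signedC-suc-suc : ∀ j r → signedC (suc j) (suc r) ≡ signedC j r + - signedC j (suc r)
  signedC-suc-suc j r = begin
    (- ι 1) ^ℚ (j ∸ r) * ι (suc j C suc r)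
      ≡⟨ cong ((- ι 1) ^ℚ (j ∸ r) *_) (trans (cong ι (sym (nCk+nC[k+1]≡[n+1]C[k+1] j r))) (ι-+ (j C r) (j C suc r))) ⟩
    (- ι 1) ^ℚ (j ∸ r) * (ι (j C r) + ι (j C suc r))
      ≡⟨ *-distribˡ-+ ((- ι 1) ^ℚ (j ∸ r)) (ι (j C r)) (ι (j C suc r)) ⟩
    signedC j r + (- ι 1) ^ℚ (j ∸ r) * ι (j C suc r)
      ≡⟨ cong (_+_ (signedC j r)) (flip (suc r ℕ.≤? j)) ⟩
    signedC j r + - signedC j (suc r) ∎
    where
    open ≡-Reasoning
    -- For r < j the exponent j - r exceeds j - (r + 1) by one, which yields the sign. Otherwise the
    -- truncated exponents agree, but both sides are zero.
    flip : Dec (r < j) → (- ι 1) ^ℚ (j ∸ r) * ι (j C suc r) ≡ - signedC j (suc r)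
    flip (yes r<j) = trans (cong (λ e → (- ι 1) ^ℚ e * ι (j C suc r)) (sym (ℕₚ.suc-pred (j ∸ r) {{ℕ.>-nonZero (ℕₚ.m<n⇒0<n∸m r<j)}})))
                   (trans (cong (λ e → (- ι 1) ^ℚ suc e * ι (j C suc r)) (ℕₚ.pred[m∸n]≡m∸[1+n] j r))
                          (solve 2 (λ p c → :- con 1ℚ :* p :* c := :- (p :* c)) refl ((- ι 1) ^ℚ (j ∸ suc r)) (ι (j C suc r))))
    flip (no r≮j)  = trans (trans (cong (λ c → (- ι 1) ^ℚ (j ∸ r) * ι c) (k>n⇒nCk≡0 (ℕₚ.≰⇒> r≮j))) (*-zeroʳ ((- ι 1) ^ℚ (j ∸ r))))
                         (cong -_ (sym (signedC-< (ℕₚ.≰⇒> r≮j))))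

  -- Induction on `m`. Pascal's rule for binom(m + 1, j + 1) gives the same sum for `m` plus a sum
  -- with shifted coefficients. By the signed Pascal rule the latter is δ(m, r - 1) - δ(m, r), or
  -- just -δ(m, 0) when r = 0; so δ(m, r) is replaced by δ(m + 1, r).
  binomial-inversion : ∀ m r K → m < K → sumTo (λ j → signedC j r * ι (m C j)) K ≡ ι ⟦ ⌊ m ℕ.≟ r ⌋ ⟧
  binomial-inversion zero r (suc K) _ = trans
    (cong₂ _+_ (start r) (trans (sumTo-cong K (λ j _ → trans (cong (λ c → signedC (suc j) r * ι c) (k>n⇒nCk≡0 {0} {suc j} (s≤s z≤n))) (*-zeroʳ (signedC (suc j) r)))) (sumTo-zero K)))
    (+-identityʳ _)
    where
    start : ∀ r → signedC 0 r * ι (0 C 0) ≡ ι ⟦ ⌊ 0 ℕ.≟ r ⌋ ⟧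
    start zero    = refl
    start (suc r) = refl
  binomial-inversion (suc m) r (suc K) (s≤s m<K) = begin
    signedC 0 r * ι (suc m C 0) + sumTo (λ j → signedC (suc j) r * ι (suc m C suc j)) K
      ≡⟨ cong (_+_ (signedC 0 r * ι (m C 0))) (trans (sumTo-cong K (λ j _ → pascal j))
           (sumTo-+ (λ j → signedC (suc j) r * ι (m C suc j)) (λ j → signedC (suc j) r * ι (m C j)) K)) ⟩
    signedC 0 r * ι (m C 0) + (sumTo (λ j → signedC (suc j) r * ι (m C suc j)) K + shifted)
      ≡⟨ +-assoc (signedC 0 r * ι (m C 0)) _ shifted ⟨
    sumTo (λ j → signedC j r * ι (m C j)) (suc K) + shifted
      -- The bound is left free above `m` so that the induction hypothesis serves both here, with K
      -- + 1 terms, and in `cancel`, with K terms.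
      ≡⟨ cong (_+ shifted) (binomial-inversion m r (suc K) (ℕₚ.m<n⇒m<1+n m<K)) ⟩
    ι ⟦ ⌊ m ℕ.≟ r ⌋ ⟧ + shifted
      ≡⟨ cancel r ⟩
    ι ⟦ ⌊ suc m ℕ.≟ r ⌋ ⟧ ∎
    where
    open ≡-Reasoning
    shifted = sumTo (λ j → signedC (suc j) r * ι (m C j)) K
    pascal : ∀ j → signedC (suc j) r * ι (suc m C suc j) ≡ signedC (suc j) r * ι (m C suc j) + signedC (suc j) r * ι (m C j)
    pascal j = trans
      (cong (signedC (suc j) r *_) (trans (cong ι (trans (sym (nCk+nC[k+1]≡[n+1]C[k+1] m j)) (ℕₚ.+-comm (m C j) _))) (ι-+ (m C suc j) (m C j))))
      (*-distribˡ-+ (signedC (suc j) r) _ _)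
    cancel : ∀ r → ι ⟦ ⌊ m ℕ.≟ r ⌋ ⟧ + sumTo (λ j → signedC (suc j) r * ι (m C j)) K ≡ ι ⟦ ⌊ suc m ℕ.≟ r ⌋ ⟧
    cancel zero = begin
      ι ⟦ ⌊ m ℕ.≟ 0 ⌋ ⟧ + sumTo (λ j → signedC (suc j) 0 * ι (m C j)) K
        ≡⟨ cong (_+_ (ι ⟦ ⌊ m ℕ.≟ 0 ⌋ ⟧)) (trans
             (sumTo-cong K (λ j _ → trans (cong (_* ι (m C j)) (signedC-suc-zero j)) (sym (neg-distribˡ-* (signedC j 0) (ι (m C j))))))
             (trans (sumTo-neg (λ j → signedC j 0 * ι (m C j)) K) (cong -_ (binomial-inversion m 0 K m<K)))) ⟩
      ι ⟦ ⌊ m ℕ.≟ 0 ⌋ ⟧ + - ι ⟦ ⌊ m ℕ.≟ 0 ⌋ ⟧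
        ≡⟨ +-inverseʳ (ι ⟦ ⌊ m ℕ.≟ 0 ⌋ ⟧) ⟩
      0ℚ ∎
    cancel (suc r) = begin
      δ + sumTo (λ j → signedC (suc j) (suc r) * ι (m C j)) K
        ≡⟨ cong (_+_ δ) (trans (sumTo-cong K (λ j _ → trans (cong (_* ι (m C j)) (signedC-suc-suc j r))
             (solve 3 (λ a b c → (a :+ :- b) :* c := a :* c :+ :- (b :* c)) refl (signedC j r) (signedC j (suc r)) (ι (m C j)))))
             (trans (sumTo-+ (λ j → signedC j r * ι (m C j)) (λ j → - (signedC j (suc r) * ι (m C j))) K)
               (cong₂ _+_ (binomial-inversion m r K m<K)
                 (trans (sumTo-neg (λ j → signedC j (suc r) * ι (m C j)) K) (cong -_ (binomial-inversion m (suc r) K m<K)))))) ⟩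
      δ + (ι ⟦ ⌊ m ℕ.≟ r ⌋ ⟧ + - δ)
        ≡⟨ solve 2 (λ a b → a :+ (b :+ :- a) := b) refl δ (ι ⟦ ⌊ m ℕ.≟ r ⌋ ⟧) ⟩
      ι ⟦ ⌊ m ℕ.≟ r ⌋ ⟧
        ≡⟨ cong (ι ∘ ⟦_⟧) (⌊⌋-cong (m ℕ.≟ r) (suc m ℕ.≟ suc r) (cong suc) ℕₚ.suc-injective) ⟩
      ι ⟦ ⌊ suc m ℕ.≟ suc r ⌋ ⟧ ∎
      where δ = ι ⟦ ⌊ m ℕ.≟ suc r ⌋ ⟧

  -- Binomial inversion for each `ρ x` separately, summed with the weights `w`. The common bound `K`
  -- cuts all these sums at the same place, so that they can be added term by term.
  exactly-from-moments : {A : Set} (xs : List A) (w ρ : A → ℕ) (r K : ℕ) → (∀ x → ρ x < K) →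
    ι (∑ xs (λ x → w x ℕ.* ⟦ ⌊ ρ x ℕ.≟ r ⌋ ⟧)) ≡ sumTo (λ j → signedC j r * ι (∑ xs (λ x → w x ℕ.* (ρ x C j)))) K
  exactly-from-moments []       w ρ r K ρ<K =
    sym (trans (sumTo-cong K (λ j _ → *-zeroʳ (signedC j r))) (sumTo-zero K))
  exactly-from-moments (x ∷ xs) w ρ r K ρ<K = begin
    ι (w x ℕ.* ⟦ ⌊ ρ x ℕ.≟ r ⌋ ⟧ ℕ.+ ∑ xs (λ x → w x ℕ.* ⟦ ⌊ ρ x ℕ.≟ r ⌋ ⟧))
      ≡⟨ ι-+ (w x ℕ.* ⟦ ⌊ ρ x ℕ.≟ r ⌋ ⟧) _ ⟩
    ι (w x ℕ.* ⟦ ⌊ ρ x ℕ.≟ r ⌋ ⟧) + ι (∑ xs (λ x → w x ℕ.* ⟦ ⌊ ρ x ℕ.≟ r ⌋ ⟧))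
      ≡⟨ cong₂ _+_ head (exactly-from-moments xs w ρ r K ρ<K) ⟩
    sumTo (λ j → signedC j r * ι (w x ℕ.* (ρ x C j))) K + sumTo (λ j → signedC j r * ι (moment j)) K
      ≡⟨ sumTo-+ (λ j → signedC j r * ι (w x ℕ.* (ρ x C j))) (λ j → signedC j r * ι (moment j)) K ⟨
    sumTo (λ j → signedC j r * ι (w x ℕ.* (ρ x C j)) + signedC j r * ι (moment j)) K
      ≡⟨ sumTo-cong K (λ j _ → sym (trans (cong (signedC j r *_) (ι-+ (w x ℕ.* (ρ x C j)) (moment j))) (*-distribˡ-+ (signedC j r) _ _))) ⟩
    sumTo (λ j → signedC j r * ι (w x ℕ.* (ρ x C j) ℕ.+ moment j)) K ∎
    where
    open ≡-Reasoning
    moment : ℕ → ℕ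
    moment j = ∑ xs (λ x → w x ℕ.* (ρ x C j))
    head : ι (w x ℕ.* ⟦ ⌊ ρ x ℕ.≟ r ⌋ ⟧) ≡ sumTo (λ j → signedC j r * ι (w x ℕ.* (ρ x C j))) K
    head = begin
      ι (w x ℕ.* ⟦ ⌊ ρ x ℕ.≟ r ⌋ ⟧)                       ≡⟨ ι-* (w x) ⟦ ⌊ ρ x ℕ.≟ r ⌋ ⟧ ⟩
      ι (w x) * ι ⟦ ⌊ ρ x ℕ.≟ r ⌋ ⟧                       ≡⟨ cong (ι (w x) *_) (binomial-inversion (ρ x) r K (ρ<K x)) ⟨
      ι (w x) * sumTo (λ j → signedC j r * ι (ρ x C j)) K ≡⟨ sumTo-* (ι (w x)) (λ j → signedC j r * ι (ρ x C j)) K ⟨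
      sumTo (λ j → ι (w x) * (signedC j r * ι (ρ x C j))) K
        ≡⟨ sumTo-cong K (λ j _ → trans (solve 3 (λ a b c → a :* (b :* c) := b :* (a :* c)) refl (ι (w x)) (signedC j r) (ι (ρ x C j)))
                                       (cong (signedC j r *_) (sym (ι-* (w x) (ρ x C j))))) ⟩
      sumTo (λ j → signedC j r * ι (w x ℕ.* (ρ x C j))) K ∎

  -- Closed form of the terms with j ≤ k.

  C-factorials : ∀ a b → ((a ℕ.+ b) C a) ℕ.* (a ! ℕ.* b !) ≡ (a ℕ.+ b) !
  C-factorials a b = begin
    ((a ℕ.+ b) C a) ℕ.* (a ! ℕ.* b !)                 ≡⟨ cong (λ e → ((a ℕ.+ b) C a) ℕ.* (a ! ℕ.* e !)) (ℕₚ.m+n∸m≡n a b) ⟨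
    ((a ℕ.+ b) C a) ℕ.* (a ! ℕ.* (a ℕ.+ b ∸ a) !)     ≡⟨ cong (ℕ._* (a ! ℕ.* (a ℕ.+ b ∸ a) !)) (nCk≡n!/k![n-k]! (ℕₚ.m≤m+n a b)) ⟩
    _                                                 ≡⟨ m/n*n≡m {{ℕₚ._!*_!≢0 a (a ℕ.+ b ∸ a)}} (k![n∸k]!∣n! (ℕₚ.m≤m+n a b)) ⟩
    (a ℕ.+ b) !                                       ∎
    where open ≡-Reasoning

  private
    -- Multiplied by r! t! s!, both sides become (r + t + s)!. Writing n as r + t + s keeps the two
    -- products of binomials free of truncation.
    trinomial-revision-≤ : ∀ r t s → ((r ℕ.+ t ℕ.+ s) C (r ℕ.+ t)) ℕ.* ((r ℕ.+ t) C r)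
                                     ≡ ((r ℕ.+ t ℕ.+ s) C r) ℕ.* ((r ℕ.+ t ℕ.+ s ∸ r) C t)
    trinomial-revision-≤ r t s =
      ℕₚ.*-cancelʳ-≡ _ _ (r ! ℕ.* (t ! ℕ.* s !)) {{ℕₚ.m*n≢0 (r !) (t ! ℕ.* s !) {{r ℕₚ.!≢0}} {{ℕₚ._!*_!≢0 t s}}}} (trans lhs (sym rhs))
      where
      open ≡-Reasoning
      open ℕ-Solver.+-*-Solver using () renaming (solve to solveℕ; _:*_ to _⊗_; _:=_ to _⊜_)
      N = r ℕ.+ t ℕ.+ s
      lhs : (N C (r ℕ.+ t)) ℕ.* ((r ℕ.+ t) C r) ℕ.* (r ! ℕ.* (t ! ℕ.* s !)) ≡ N !
      lhs = begin
        (N C (r ℕ.+ t)) ℕ.* ((r ℕ.+ t) C r) ℕ.* (r ! ℕ.* (t ! ℕ.* s !))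
          ≡⟨ solveℕ 5 (λ a b x y z → a ⊗ b ⊗ (x ⊗ (y ⊗ z)) ⊜ a ⊗ (b ⊗ (x ⊗ y) ⊗ z)) refl (N C (r ℕ.+ t)) ((r ℕ.+ t) C r) (r !) (t !) (s !) ⟩
        (N C (r ℕ.+ t)) ℕ.* (((r ℕ.+ t) C r) ℕ.* (r ! ℕ.* t !) ℕ.* s !)
          ≡⟨ cong (λ x → (N C (r ℕ.+ t)) ℕ.* (x ℕ.* s !)) (C-factorials r t) ⟩
        (N C (r ℕ.+ t)) ℕ.* ((r ℕ.+ t) ! ℕ.* s !)
          ≡⟨ C-factorials (r ℕ.+ t) s ⟩
        N ! ∎
      rhs : (N C r) ℕ.* ((N ∸ r) C t) ℕ.* (r ! ℕ.* (t ! ℕ.* s !)) ≡ N !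
      rhs = begin
        (N C r) ℕ.* ((N ∸ r) C t) ℕ.* (r ! ℕ.* (t ! ℕ.* s !))
          ≡⟨ cong (λ M → (M C r) ℕ.* ((M ∸ r) C t) ℕ.* (r ! ℕ.* (t ! ℕ.* s !))) (ℕₚ.+-assoc r t s) ⟩
        ((r ℕ.+ (t ℕ.+ s)) C r) ℕ.* ((r ℕ.+ (t ℕ.+ s) ∸ r) C t) ℕ.* (r ! ℕ.* (t ! ℕ.* s !))
          ≡⟨ cong (λ M → ((r ℕ.+ (t ℕ.+ s)) C r) ℕ.* (M C t) ℕ.* (r ! ℕ.* (t ! ℕ.* s !))) (ℕₚ.m+n∸m≡n r (t ℕ.+ s)) ⟩
        ((r ℕ.+ (t ℕ.+ s)) C r) ℕ.* ((t ℕ.+ s) C t) ℕ.* (r ! ℕ.* (t ! ℕ.* s !))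
          ≡⟨ solveℕ 4 (λ a b x y → a ⊗ b ⊗ (x ⊗ y) ⊜ a ⊗ (x ⊗ (b ⊗ y))) refl ((r ℕ.+ (t ℕ.+ s)) C r) ((t ℕ.+ s) C t) (r !) (t ! ℕ.* s !) ⟩
        ((r ℕ.+ (t ℕ.+ s)) C r) ℕ.* (r ! ℕ.* (((t ℕ.+ s) C t) ℕ.* (t ! ℕ.* s !)))
          ≡⟨ cong (λ x → ((r ℕ.+ (t ℕ.+ s)) C r) ℕ.* (r ! ℕ.* x)) (C-factorials t s) ⟩
        ((r ℕ.+ (t ℕ.+ s)) C r) ℕ.* (r ! ℕ.* (t ℕ.+ s) !)
          ≡⟨ C-factorials r (t ℕ.+ s) ⟩
        (r ℕ.+ (t ℕ.+ s)) !
          ≡⟨ cong _! (ℕₚ.+-assoc r t s) ⟨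
        N ! ∎

  trinomial-revision : ∀ n r t → (n C (r ℕ.+ t)) ℕ.* ((r ℕ.+ t) C r) ≡ (n C r) ℕ.* ((n ∸ r) C t)
  trinomial-revision n r t with r ℕ.+ t ℕ.≤? n
  ... | yes r+t≤n = subst (λ m → (m C (r ℕ.+ t)) ℕ.* ((r ℕ.+ t) C r) ≡ (m C r) ℕ.* ((m ∸ r) C t))
                          (ℕₚ.m+[n∸m]≡n r+t≤n) (trinomial-revision-≤ r t (n ∸ (r ℕ.+ t)))
  ... | no r+t≰n = trans (cong (ℕ._* ((r ℕ.+ t) C r)) (k>n⇒nCk≡0 (ℕₚ.≰⇒> r+t≰n))) (sym vanish)
    where
    -- When r + t > n, either r > n already, or t > n - r and the second factor vanishes.
    vanish : (n C r) ℕ.* ((n ∸ r) C t) ≡ 0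
    vanish with r ℕ.≤? n
    ... | no r≰n  = cong (ℕ._* ((n ∸ r) C t)) (k>n⇒nCk≡0 (ℕₚ.≰⇒> r≰n))
    ... | yes r≤n = trans (cong ((n C r) ℕ.*_) (k>n⇒nCk≡0
      (ℕₚ.≰⇒> (λ t≤ → r+t≰n (subst (r ℕ.+ t ≤_) (ℕₚ.m+[n∸m]≡n r≤n) (ℕₚ.+-monoʳ-≤ r t≤)))))) (ℕₚ.*-zeroʳ (n C r))

  power-shift : ∀ q .{{_ : ℕ.NonZero q}} e t → t ≤ e →
                (- ι 1) ^ℚ t * ι q ^ℚ (e ∸ t) ≡ ι q ^ℚ e * (- inv q) ^ℚ t
  power-shift q e       zero    _         = trans (*-identityˡ (ι q ^ℚ e)) (sym (*-identityʳ (ι q ^ℚ e)))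
  power-shift q (suc e) (suc t) (s≤s t≤e) = begin
    (- ι 1) * s * Q                       ≡⟨ *-assoc (- ι 1) s Q ⟩
    (- ι 1) * (s * Q)                     ≡⟨ cong ((- ι 1) *_) (power-shift q e t t≤e) ⟩
    (- ι 1) * (P * I)                     ≡⟨ cong (λ x → (- x) * (P * I)) (sym (inv-*-ι q)) ⟩
    (- (inv q * ι q)) * (P * I)           ≡⟨ solve 4 (λ i q P I → (:- (i :* q)) :* (P :* I) := q :* P :* (:- i :* I)) refl (inv q) (ι q) P I ⟩
    ι q * P * (- inv q * I)               ∎
    where
    open ≡-Reasoning
    s = (- ι 1) ^ℚ t
    Q = ι q ^ℚ (e ∸ t)
    P = ι q ^ℚ e
    I = (- inv q) ^ℚ t

  -- The terms with j < r vanish, and j = r + t turns binom(n, j) binom(j, r) into binom(n, r)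
  -- binom(n - r, t), whose first factor leaves the sum. For r > k every term on the left vanishes
  -- and the sum on the right is empty, so the truncated exponent `k ∸ r` does no harm.
  main-term : ∀ q .{{_ : ℕ.NonZero q}} n k r →
    sumTo (λ j → signedC j r * (ι q ^ℚ (k ∸ j) * ι (n C j))) (suc k)
    ≡ ι q ^ℚ (k ∸ r) * ι (n C r) * sumTo (λ j → (- inv q) ^ℚ j * ι ((n ∸ r) C j)) (suc k ∸ r)
  main-term q n k r = cases (r ℕ.≤? k)
    where
    open ≡-Reasoning
    f g : ℕ → ℚ
    f j = signedC j r * (ι q ^ℚ (k ∸ j) * ι (n C j))
    g j = (- inv q) ^ℚ j * ι ((n ∸ r) C j)
    c = ι q ^ℚ (k ∸ r) * ι (n C r)
    below : ∀ {j} → j < r → f j ≡ 0ℚ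
    below {j} j<r = trans (cong (_* (ι q ^ℚ (k ∸ j) * ι (n C j))) (signedC-< j<r)) (*-zeroˡ (ι q ^ℚ (k ∸ j) * ι (n C j)))
    term : r ≤ k → ∀ t → t < suc k ∸ r → f (r ℕ.+ t) ≡ c * g t
    term r≤k t t< = begin
      (- ι 1) ^ℚ (r ℕ.+ t ∸ r) * ι ((r ℕ.+ t) C r) * (ι q ^ℚ (k ∸ (r ℕ.+ t)) * ι (n C (r ℕ.+ t)))
        ≡⟨ cong₂ (λ a b → (- ι 1) ^ℚ a * ι ((r ℕ.+ t) C r) * (ι q ^ℚ b * ι (n C (r ℕ.+ t)))) (ℕₚ.m+n∸m≡n r t) (sym (ℕₚ.∸-+-assoc k r t)) ⟩
      (- ι 1) ^ℚ t * ι ((r ℕ.+ t) C r) * (ι q ^ℚ (k ∸ r ∸ t) * ι (n C (r ℕ.+ t)))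
        ≡⟨ solve 4 (λ a b c d → a :* b :* (c :* d) := a :* c :* (d :* b)) refl
             ((- ι 1) ^ℚ t) (ι ((r ℕ.+ t) C r)) (ι q ^ℚ (k ∸ r ∸ t)) (ι (n C (r ℕ.+ t))) ⟩
      (- ι 1) ^ℚ t * ι q ^ℚ (k ∸ r ∸ t) * (ι (n C (r ℕ.+ t)) * ι ((r ℕ.+ t) C r))
        ≡⟨ cong₂ _*_ (power-shift q (k ∸ r) t (ℕ.s≤s⁻¹ (subst (t <_) (ℕₚ.+-∸-assoc 1 r≤k) t<)))
             (trans (sym (ι-* (n C (r ℕ.+ t)) ((r ℕ.+ t) C r))) (trans (cong ι (trinomial-revision n r t)) (ι-* (n C r) ((n ∸ r) C t)))) ⟩
      ι q ^ℚ (k ∸ r) * (- inv q) ^ℚ t * (ι (n C r) * ι ((n ∸ r) C t))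
        ≡⟨ solve 4 (λ a b c d → a :* b :* (c :* d) := a :* c :* (b :* d)) refl
             (ι q ^ℚ (k ∸ r)) ((- inv q) ^ℚ t) (ι (n C r)) (ι ((n ∸ r) C t)) ⟩
      c * g t ∎
    cases : Dec (r ≤ k) → sumTo f (suc k) ≡ c * sumTo g (suc k ∸ r)
    cases (no r≰k) = begin
      sumTo f (suc k)
        ≡⟨ sumTo-cong (suc k) (λ j j<1+k → below (ℕₚ.≤-trans j<1+k (ℕₚ.≰⇒> r≰k))) ⟩
      sumTo (λ _ → 0ℚ) (suc k)   ≡⟨ sumTo-zero (suc k) ⟩
      0ℚ                         ≡⟨ *-zeroʳ c ⟨
      c * sumTo g 0              ≡⟨ cong (λ e → c * sumTo g e) (ℕₚ.m≤n⇒m∸n≡0 (ℕₚ.≰⇒> r≰k)) ⟨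
      c * sumTo g (suc k ∸ r)    ∎
    cases (yes r≤k) = begin
      sumTo f (suc k)                                       ≡⟨ cong (sumTo f) (ℕₚ.m+[n∸m]≡n (ℕₚ.m≤n⇒m≤1+n r≤k)) ⟨
      sumTo f (r ℕ.+ (suc k ∸ r))                           ≡⟨ sumTo-split f r (suc k ∸ r) ⟩
      sumTo f r + sumTo (λ t → f (r ℕ.+ t)) (suc k ∸ r)
        ≡⟨ cong₂ _+_ (trans (sumTo-cong r (λ j → below)) (sumTo-zero r))
                     (sumTo-cong (suc k ∸ r) (term r≤k)) ⟩
      0ℚ + sumTo (λ t → c * g t) (suc k ∸ r)                ≡⟨ +-identityˡ _ ⟩
      sumTo (λ t → c * g t) (suc k ∸ r)                     ≡⟨ sumTo-* c g (suc k ∸ r) ⟩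
      c * sumTo g (suc k ∸ r)                               ∎

open Inversion

-- Monic polynomials and their linear factors.

module Polynomials (𝔽 : FiniteField) where
  open 𝔹 using (T)
  open FiniteField 𝔽 renaming (_+_ to infixl 6 _+_; _*_ to infixl 7 _*_; -_ to infix 8 -_)
  open Poly 𝔽

  commutativeRing : CommutativeRing _ _
  commutativeRing = record { isCommutativeRing = isCommutativeRing }

  open CommutativeRing commutativeRing
    using (+-identityˡ; +-identityʳ; +-comm; +-assoc; *-identityˡ; *-identityʳ; zeroˡ; zeroʳ;
           *-comm; -‿inverseˡ; -‿inverseʳ; ring; commutativeSemiring)
  open RingProperties ring using (+-cancelˡ; +-cancelʳ)
  open RingSolver commutativeSemiring using (solve; _:+_; _:*_; _:=_)

  -- The coefficients after the leading c of (x + α) (c x^d + v₁ x^(d-1) + … + v_d).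
  times : Carrier → Carrier → List Carrier → List Carrier
  times α c []      = [ α * c ]
  times α c (x ∷ v) = (x + α * c) ∷ times α x v

  -- (x + α₁) ⋯ (x + α_m) u, for u monic given by its coefficients after the leading 1.
  timesAll : List Carrier → List Carrier → List Carrier
  timesAll xs u = foldr (λ α → times α 1#) u xs

  -- Comparison with the multiplication of ascending coefficient lists

  -- The ascending coefficients of (x + α) p + b. In the recursion `b` is the coefficient read just
  -- before, which multiplication by x moves up one degree.
  shiftAdd : Carrier → Carrier → Pol → Pol
  shiftAdd α b []      = [ b ]
  shiftAdd α b (y ∷ p) = (α * y + b) ∷ shiftAdd α y p

  addP-identityʳ : ∀ p → addP p [] ≡ p
  addP-identityʳ []      = refl
  addP-identityʳ (_ ∷ _) = refl

  addP-scale-shift : ∀ α b p → addP (map (α *_) p) (b ∷ p) ≡ shiftAdd α b p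
  addP-scale-shift α b []      = refl
  addP-scale-shift α b (y ∷ p) = cong ((α * y + b) ∷_) (addP-scale-shift α y p)

  mulP-one : ∀ y p → mulP [ 1# ] (y ∷ p) ≡ y ∷ p
  mulP-one y p = cong₂ _∷_ (trans (+-identityʳ _) (*-identityˡ y)) (trans (addP-identityʳ _) (LP.map-id-local (All.universal *-identityˡ p)))

  mulP-linear : ∀ α y p → mulP (linear α) (y ∷ p) ≡ shiftAdd α 0# (y ∷ p)
  mulP-linear α y p = trans (cong (λ q → addP (map (α *_) (y ∷ p)) (0# ∷ q)) (mulP-one y p)) (addP-scale-shift α 0# (y ∷ p))

  shiftAdd-addP : ∀ α b c p q → shiftAdd α (b + c) (addP p q) ≡ addP (shiftAdd α b p) (shiftAdd α c q)
  shiftAdd-addP α b c []      []      = refl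
  shiftAdd-addP α b c []      (y ∷ q) = cong₂ _∷_ (solve 3 (λ u v w → u :+ (v :+ w) := v :+ (u :+ w)) refl (α * y) b c) refl
  shiftAdd-addP α b c (x ∷ p) []      = cong₂ _∷_ (sym (+-assoc (α * x) b c)) (sym (addP-identityʳ _))
  shiftAdd-addP α b c (x ∷ p) (y ∷ q) = cong₂ _∷_
    (solve 5 (λ α x y b c → α :* (x :+ y) :+ (b :+ c) := (α :* x :+ b) :+ (α :* y :+ c)) refl α x y b c)
    (shiftAdd-addP α x y p q)

  shiftAdd-scale : ∀ α a b p → shiftAdd α (a * b) (map (a *_) p) ≡ map (a *_) (shiftAdd α b p)
  shiftAdd-scale α a b []      = refl
  shiftAdd-scale α a b (y ∷ p) = cong₂ _∷_
    (solve 4 (λ α a b y → α :* (a :* y) :+ a :* b := a :* (α :* y :+ b)) refl α a b y) (shiftAdd-scale α a y p)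

  -- The one fragment of commutativity and associativity that is needed: a linear factor can be
  -- pulled out of the second argument. Both arguments are nonempty because with an empty one the
  -- two lists have different lengths.
  mulP-shiftAdd : ∀ α a u b p → mulP (a ∷ u) (shiftAdd α 0# (b ∷ p)) ≡ shiftAdd α 0# (mulP (a ∷ u) (b ∷ p))
  mulP-shiftAdd α a u b p = begin
    addP (map (a *_) (shiftAdd α 0# P)) (0# ∷ mulP u (shiftAdd α 0# P))
      ≡⟨ cong (λ q → addP q (0# ∷ mulP u (shiftAdd α 0# P)))
              (sym (trans (cong (λ z → shiftAdd α z (map (a *_) P)) (sym (zeroʳ a))) (shiftAdd-scale α a 0# P))) ⟩
    addP (shiftAdd α 0# (map (a *_) P)) (0# ∷ mulP u (shiftAdd α 0# P))
      ≡⟨ tail u ⟩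
    addP (shiftAdd α 0# (map (a *_) P)) (shiftAdd α 0# (0# ∷ mulP u P))
      ≡⟨ shiftAdd-addP α 0# 0# (map (a *_) P) (0# ∷ mulP u P) ⟨
    shiftAdd α (0# + 0#) (mulP (a ∷ u) P)
      ≡⟨ cong (λ z → shiftAdd α z (mulP (a ∷ u) P)) (+-identityˡ 0#) ⟩
    shiftAdd α 0# (mulP (a ∷ u) P) ∎
    where
    open ≡-Reasoning
    P = b ∷ p
    α0+0 : 0# ≡ α * 0# + 0#
    α0+0 = sym (trans (+-identityʳ _) (zeroʳ α))
    tail : ∀ u → addP (shiftAdd α 0# (map (a *_) P)) (0# ∷ mulP u (shiftAdd α 0# P))
                 ≡ addP (shiftAdd α 0# (map (a *_) P)) (shiftAdd α 0# (0# ∷ mulP u P))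
    -- Here the second summand on the right has one trailing zero more than that on the left. It is
    -- absorbed, since the first summand has at least two entries.
    tail []      = cong₂ _∷_ (cong (α * (a * b) + 0# +_) α0+0) (low (a * b) (map (a *_) p))
      where
      low : ∀ c q → addP (shiftAdd α c q) [] ≡ addP (shiftAdd α c q) [ 0# ]
      low c []      = cong [_] (sym (+-identityʳ c))
      low c (y ∷ q) = cong₂ _∷_ (sym (+-identityʳ _)) (sym (addP-identityʳ _))
    tail (c ∷ u) = cong (addP (shiftAdd α 0# (map (a *_) P))) (cong₂ _∷_ α0+0 (mulP-shiftAdd α c u b p))

  private
    -- All but the top coefficient of `shiftAdd α b (p ++ [ x ])`. Reversal must match exactly this
    -- part with `times`, whose result omits the leading coefficient too.
    lower : Carrier → Carrier → Pol → Carrier → Pol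
    lower α b []      x = [ α * x + b ]
    lower α b (y ∷ p) x = (α * y + b) ∷ lower α y p x

    shiftAdd-snoc : ∀ α b p x → shiftAdd α b (p ++ [ x ]) ≡ lower α b p x ++ [ x ]
    shiftAdd-snoc α b []      x = refl
    shiftAdd-snoc α b (y ∷ p) x = cong (_ ∷_) (shiftAdd-snoc α y p x)

    lower-snoc : ∀ α b p y x → lower α b (p ++ [ y ]) x ≡ lower α b p y ++ [ α * x + y ]
    lower-snoc α b []      y x = refl
    lower-snoc α b (z ∷ p) y x = cong (_ ∷_) (lower-snoc α z p y x)

    reverse-times : ∀ α c v → reverse (times α c v) ≡ lower α 0# (reverse v) c
    reverse-times α c []      = cong [_] (sym (+-identityʳ _))
    reverse-times α c (x ∷ v) = begin
      reverse ((x + α * c) ∷ times α x v)             ≡⟨ unfold-reverse _ (times α x v) ⟩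
      reverse (times α x v) ++ [ x + α * c ]          ≡⟨ cong₂ (λ p y → p ++ [ y ]) (reverse-times α x v) (+-comm x (α * c)) ⟩
      lower α 0# (reverse v) x ++ [ α * c + x ]       ≡⟨ lower-snoc α 0# (reverse v) x c ⟨
      lower α 0# (reverse v ++ [ x ]) c               ≡⟨ cong (λ p → lower α 0# p c) (unfold-reverse x v) ⟨
      lower α 0# (reverse (x ∷ v)) c                  ∎
      where open ≡-Reasoning

  shiftAdd-reverse : ∀ α c v → shiftAdd α 0# (reverse (c ∷ v)) ≡ reverse (c ∷ times α c v)
  shiftAdd-reverse α c v = begin
    shiftAdd α 0# (reverse (c ∷ v))       ≡⟨ cong (shiftAdd α 0#) (unfold-reverse c v) ⟩
    shiftAdd α 0# (reverse v ++ [ c ])    ≡⟨ shiftAdd-snoc α 0# (reverse v) c ⟩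
    lower α 0# (reverse v) c ++ [ c ]     ≡⟨ cong (_++ [ c ]) (reverse-times α c v) ⟨
    reverse (times α c v) ++ [ c ]        ≡⟨ unfold-reverse c (times α c v) ⟨
    reverse (c ∷ times α c v)             ∎
    where open ≡-Reasoning

  mulP-identityʳ : ∀ p → mulP p [ 1# ] ≡ p
  mulP-identityʳ []      = refl
  mulP-identityʳ (a ∷ p) = cong₂ _∷_ (trans (+-identityʳ _) (*-identityʳ a)) (mulP-identityʳ p)

  prodLin-nonempty : ∀ xs → ∃ λ b → ∃ λ p → prodLin xs ≡ b ∷ p
  prodLin-nonempty []       = 1# , [] , refl
  prodLin-nonempty (α ∷ xs) with prodLin xs | prodLin-nonempty xs
  ... | _ | b , p , refl = _ , _ , refl

  reverse-nonempty : ∀ c v → ∃ λ b → ∃ λ p → reverse (c ∷ v) ≡ b ∷ p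
  reverse-nonempty c v rewrite unfold-reverse {A = Carrier} c v with reverse v
  ... | []    = _ , _ , refl
  ... | _ ∷ _ = _ , _ , refl

  -- The bridge from `mulP` to `timesAll`: linear factors are pulled out one at a time, and each
  -- acts on the reversed list as `times` does.
  mulP-prodLin : ∀ u xs → mulP (reverse (1# ∷ u)) (prodLin xs) ≡ reverse (1# ∷ timesAll xs u)
  mulP-prodLin u []       = mulP-identityʳ _
  mulP-prodLin u (α ∷ xs) = begin
    mulP U (mulP (linear α) (prodLin xs))  ≡⟨ lift U (reverse-nonempty 1# u) (prodLin xs) (prodLin-nonempty xs) ⟩
    shiftAdd α 0# (mulP U (prodLin xs))    ≡⟨ cong (shiftAdd α 0#) (mulP-prodLin u xs) ⟩
    shiftAdd α 0# (reverse (1# ∷ timesAll xs u)) ≡⟨ shiftAdd-reverse α 1# (timesAll xs u) ⟩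
    reverse (1# ∷ times α 1# (timesAll xs u)) ∎
    where
    open ≡-Reasoning
    U = reverse (1# ∷ u)
    lift : ∀ p → ∃ (λ a → ∃ λ p′ → p ≡ a ∷ p′) → ∀ q → ∃ (λ b → ∃ λ q′ → q ≡ b ∷ q′) →
           mulP p (mulP (linear α) q) ≡ shiftAdd α 0# (mulP p q)
    lift _ (a , p , refl) _ (b , q , refl) = trans (cong (mulP (a ∷ p)) (mulP-linear α b q)) (mulP-shiftAdd α a p b q)

  length-times : ∀ α c v → length (times α c v) ≡ suc (length v)
  length-times α c []      = refl
  length-times α c (x ∷ v) = cong suc (length-times α x v)

  length-timesAll : ∀ xs u → length (timesAll xs u) ≡ length xs ℕ.+ length u
  length-timesAll []       u = refl
  length-timesAll (α ∷ xs) u = trans (length-times α 1# (timesAll xs u)) (cong suc (length-timesAll xs u))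

  ≤-timesAll : ∀ {ℓ} xs {u} → ℓ ≤ length u → ℓ ≤ length (timesAll xs u)
  ≤-timesAll xs {u} h = subst (_ ≤_) (sym (length-timesAll xs u)) (ℕₚ.≤-trans h (ℕₚ.m≤n+m (length u) (length xs)))

  -- The coefficients are determined from the top: `c` is known, so `x + α * c` gives `x`, which
  -- takes the place of `c` in the next step.
  times-injective : ∀ α c {v w} → times α c v ≡ times α c w → v ≡ w
  times-injective α c {[]}        {[]}        eq = refl
  times-injective α c {[]}        {x ∷ []}    eq with () ← ∷-injectiveʳ eq
  times-injective α c {[]}        {x ∷ _ ∷ _} eq with () ← ∷-injectiveʳ eq
  times-injective α c {x ∷ []}    {[]}        eq with () ← ∷-injectiveʳ eq
  times-injective α c {x ∷ _ ∷ _} {[]}        eq with () ← ∷-injectiveʳ eq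
  times-injective α c {x ∷ v}     {y ∷ w}     eq
    with refl ← +-cancelʳ (α * c) x y (∷-injectiveˡ eq) = cong (x ∷_) (times-injective α x (∷-injectiveʳ eq))

  timesAll-injective : ∀ xs {u w} → timesAll xs u ≡ timesAll xs w → u ≡ w
  timesAll-injective []       eq = eq
  timesAll-injective (α ∷ xs) eq = timesAll-injective xs (times-injective α 1# eq)

  private
    -- The invariant behind `times-comm`. If `c` and `b` are the last two coefficients read, the
    -- inner pass has just produced `b + β * c`, and the outer pass continues from there.
    times-times : ∀ α β c b v → times α (b + β * c) (times β b v) ≡ times β (b + α * c) (times α b v)
    times-times α β c b [] = cong₂ _∷_
      (solve 4 (λ α β b c → β :* b :+ α :* (b :+ β :* c) := α :* b :+ β :* (b :+ α :* c)) refl α β b c)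
      (cong [_] (solve 3 (λ α β b → α :* (β :* b) := β :* (α :* b)) refl α β b))
    times-times α β c b (x ∷ v) = cong₂ _∷_
      (solve 5 (λ α β b c x → (x :+ β :* b) :+ α :* (b :+ β :* c) := (x :+ α :* b) :+ β :* (b :+ α :* c)) refl α β b c x)
      (times-times α β b x v)

  times-comm : ∀ α β c v → times α c (times β c v) ≡ times β c (times α c v)
  times-comm α β c []      = cong₂ _∷_ (+-comm _ _) (cong [_] (solve 3 (λ α β b → α :* (β :* b) := β :* (α :* b)) refl α β c))
  times-comm α β c (x ∷ v) = cong₂ _∷_
    (solve 4 (λ α β c x → (x :+ β :* c) :+ α :* c := (x :+ α :* c) :+ β :* c) refl α β c x)
    (times-times α β c x v)

  timesAll-↭ : ∀ {xs ys} u → xs ↭ ys → timesAll xs u ≡ timesAll ys u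
  timesAll-↭ u Perm.refl        = refl
  timesAll-↭ u (prep α p)       = cong (times α 1#) (timesAll-↭ u p)
  timesAll-↭ u (swap α β p)     = trans (cong (times α 1# ∘ times β 1#) (timesAll-↭ u p)) (times-comm α β 1# _)
  timesAll-↭ u (Perm.trans p q) = trans (timesAll-↭ u p) (timesAll-↭ u q)

  timesAll-times : ∀ xs α u → timesAll xs (times α 1# u) ≡ times α 1# (timesAll xs u)
  timesAll-times []       α u = refl
  timesAll-times (β ∷ xs) α u = trans (cong (times β 1#) (timesAll-times xs α u)) (times-comm β α 1# _)

  -- Evaluation and the factor theorem

  horner : Carrier → Carrier → List Carrier → Carrier
  horner x c []      = c
  horner x c (a ∷ v) = horner x (c * x + a) v

  -- Two Horner evaluations in parallel. If `a` is the value accumulated for the factor before its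
  -- coefficient `c` is read, the product has accumulated `(x + α) * a + c`, because it still lacks
  -- the contribution α c. The evaluation starts from a = 0.
  horner-times : ∀ x α a c v → horner x ((x + α) * a + c) (times α c v) ≡ (x + α) * horner x (x * a + c) v
  horner-times x α a c [] =
    solve 4 (λ x α a c → ((x :+ α) :* a :+ c) :* x :+ α :* c := (x :+ α) :* (x :* a :+ c)) refl x α a c
  horner-times x α a c (y ∷ v) = begin
    horner x (((x + α) * a + c) * x + (y + α * c)) (times α y v)
      ≡⟨ cong (λ z → horner x z (times α y v))
           (solve 5 (λ x α a c y → ((x :+ α) :* a :+ c) :* x :+ (y :+ α :* c) := (x :+ α) :* (x :* a :+ c) :+ y) refl x α a c y) ⟩
    horner x ((x + α) * (x * a + c) + y) (times α y v)
      ≡⟨ horner-times x α (x * a + c) y v ⟩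
    (x + α) * horner x (x * (x * a + c) + y) v
      ≡⟨ cong (λ z → (x + α) * horner x (z + y) v) (*-comm x _) ⟩
    (x + α) * horner x ((x * a + c) * x + y) v ∎
    where open ≡-Reasoning

  horner-times₁ : ∀ x α v → horner x 1# (times α 1# v) ≡ (x + α) * horner x 1# v
  horner-times₁ x α v = begin
    horner x 1# (times α 1# v)                    ≡⟨ cong (λ z → horner x z (times α 1# v)) (absorb (x + α)) ⟨
    horner x ((x + α) * 0# + 1#) (times α 1# v)   ≡⟨ horner-times x α 0# 1# v ⟩
    (x + α) * horner x (x * 0# + 1#) v            ≡⟨ cong (λ z → (x + α) * horner x z v) (absorb x) ⟩
    (x + α) * horner x 1# v                       ∎
    where
    open ≡-Reasoning
    absorb : ∀ y → y * 0# + 1# ≡ 1#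
    absorb y = trans (cong (_+ 1#) (zeroʳ y)) (+-identityˡ 1#)

  zero-product : ∀ {a b} → ¬ (a ≡ 0#) → a * b ≡ 0# → b ≡ 0#
  zero-product {a} {b} a≢0 ab≡0 with a⁻¹ , aa⁻¹ ← inverse a a≢0 = begin
    b              ≡⟨ *-identityˡ b ⟨
    1# * b         ≡⟨ cong (_* b) aa⁻¹ ⟨
    a * a⁻¹ * b    ≡⟨ solve 3 (λ a c b → a :* c :* b := c :* (a :* b)) refl a a⁻¹ b ⟩
    a⁻¹ * (a * b)  ≡⟨ cong (a⁻¹ *_) ab≡0 ⟩
    a⁻¹ * 0#       ≡⟨ zeroʳ a⁻¹ ⟩
    0#             ∎
    where open ≡-Reasoning

  -- At -α a factor x + β takes the value -α + β, which is nonzero for β ≠ α and can be cancelled.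
  -- This takes the place of a coprimality argument.
  root-timesAll : ∀ α xs u → All (λ β → ¬ (α ≡ β)) xs → horner (- α) 1# (timesAll xs u) ≡ 0# → horner (- α) 1# u ≡ 0#
  root-timesAll α []       u []            eq = eq
  root-timesAll α (β ∷ xs) u (α≢β ∷ α∉) eq = root-timesAll α xs u α∉
    (zero-product (λ -α+β≡0 → α≢β (α≡β -α+β≡0)) (trans (sym (horner-times₁ (- α) β (timesAll xs u))) eq))
    where
    α≡β : - α + β ≡ 0# → α ≡ β
    α≡β eq = begin
      α               ≡⟨ +-identityʳ α ⟨
      α + 0#          ≡⟨ cong (α +_) eq ⟨
      α + (- α + β)   ≡⟨ +-assoc α (- α) β ⟨
      α + - α + β     ≡⟨ cong (_+ β) (-‿inverseʳ α) ⟩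
      0# + β          ≡⟨ +-identityˡ β ⟩
      β               ∎
      where open ≡-Reasoning

  root-times : ∀ α u → horner (- α) 1# (times α 1# u) ≡ 0#
  root-times α u = trans (horner-times₁ (- α) α u) (trans (cong (_* horner (- α) 1# u) (-‿inverseˡ α)) (zeroˡ _))

  private
    divide-coeff : ∀ α c y → (c * - α + y) + α * c ≡ y
    divide-coeff α c y = begin
      (c * - α + y) + α * c   ≡⟨ solve 4 (λ α m c y → (c :* m :+ y) :+ α :* c := c :* (m :+ α) :+ y) refl α (- α) c y ⟩
      c * (- α + α) + y       ≡⟨ cong (λ z → c * z + y) (-‿inverseˡ α) ⟩
      c * 0# + y              ≡⟨ cong (_+ y) (zeroʳ c) ⟩
      0# + y                  ≡⟨ +-identityˡ y ⟩
      y                       ∎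
      where open ≡-Reasoning

  -- Synthetic division: the Horner values at -α are the coefficients of the quotient, and the last
  -- one is the remainder. The arbitrary leading coefficient `c` makes the recursion possible.
  factor-theorem : ∀ α c y w → horner (- α) c (y ∷ w) ≡ 0# → ∃ λ u → times α c u ≡ y ∷ w
  factor-theorem α c y [] eq = [] , cong [_] (begin
    α * c                       ≡⟨ +-identityˡ _ ⟨
    0# + α * c                  ≡⟨ cong (_+ α * c) eq ⟨
    (c * - α + y) + α * c       ≡⟨ divide-coeff α c y ⟩
    y                           ∎)
    where open ≡-Reasoning
  factor-theorem α c y (z ∷ w) eq with u , eq′ ← factor-theorem α (c * - α + y) z w eq =
    (c * - α + y) ∷ u , cong₂ _∷_ (divide-coeff α c y) eq′

  -- Divisibility by products of linear factors

  leading-monic : ∀ ℓ u → leading ℓ (reverse (1# ∷ u)) ≡ takePad ℓ u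
  leading-monic ℓ u = cong (takePad ℓ ∘ List.drop 1) (reverse-involutive (1# ∷ u))

  toVec : ∀ {A : Set} {e} (u : List A) → length u ≡ e → ∃ λ (v : Vec A e) → toList v ≡ u
  toVec u refl = fromList u , VP.toList∘fromList u

  toList-inj : ∀ {A : Set} {e} {v w : Vec A e} → toList v ≡ toList w → v ≡ w
  toList-inj {v = v} {w} eq = trans (sym (VP.cast-is-id refl v)) (VP.toList-injective refl v w eq)

  divides-sound : ∀ xs {d} (g : Vec Carrier d) → T (divides xs g) →
    length xs ≤ d × ∃ λ (u : Vec Carrier (d ∸ length xs)) → timesAll xs (toList u) ≡ toList g
  divides-sound xs {d} g h with ≤d , some ← Equivalence.to T-∧ h
    with u , _ , eq ← find (any⁻ _ (allVecs elements (d ∸ length xs)) some)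
    = ℕₚ.≤ᵇ⇒≤ (length xs) d ≤d , u ,
      ∷-injectiveʳ (reverse-injective (trans (sym (mulP-prodLin (toList u) xs)) (toWitness eq)))

  -- The cofactor is a plain list, as the equation forces its length to be d - |xs|; callers need
  -- not produce a vector of that length.
  divides-complete : ∀ xs {d} (g : Vec Carrier d) u → timesAll xs u ≡ toList g → T (divides xs g)
  divides-complete xs {d} g u eq = Equivalence.from T-∧
      ( ℕₚ.≤⇒≤ᵇ (subst (length xs ≤_) length-g (ℕₚ.m≤m+n (length xs) (length u)))
      , any⁺ _ (lose (allVecs-complete elements-complete (proj₁ v)) (fromWitness product)) )
    where
    length-g : length xs ℕ.+ length u ≡ d
    length-g = trans (sym (length-timesAll xs u)) (trans (cong length eq) (VP.length-toList g))
    v : ∃ λ (v : Vec Carrier (d ∸ length xs)) → toList v ≡ u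
    v = toVec u (trans (sym (ℕₚ.m+n∸m≡n (length xs) (length u))) (cong (_∸ length xs) length-g))
    product : mulP (monic (proj₁ v)) (prodLin xs) ≡ monic g
    product = trans (mulP-prodLin (toList (proj₁ v)) xs)
      (cong (λ w → reverse (1# ∷ w)) (trans (cong (timesAll xs) (proj₂ v)) eq))

  -- For the converse, let u be the cofactor of g with respect to `xs`. Since -α is a root of g but
  -- of none of the factors in `xs`, it is a root of u, and x + α splits off from u.
  divides-∷ : ∀ α xs {d} (g : Vec Carrier d) → All (λ β → ¬ (α ≡ β)) xs →
              divides (α ∷ xs) g ≡ divides [ α ] g ∧ divides xs g
  divides-∷ α xs g α∉ = T-ext to from
    where
    to : T (divides (α ∷ xs) g) → T (divides [ α ] g ∧ divides xs g)
    to h with _ , u , eq ← divides-sound (α ∷ xs) g h = Equivalence.from T-∧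
      ( divides-complete [ α ] g (timesAll xs (toList u)) eq
      , divides-complete xs g (times α 1# (toList u)) (trans (timesAll-times xs α (toList u)) eq) )
    from : T (divides [ α ] g ∧ divides xs g) → T (divides (α ∷ xs) g)
    from h with hα , hxs ← Equivalence.to (T-∧ {divides [ α ] g}) h
      with _ , w , eqα ← divides-sound [ α ] g hα | _ , u , eq ← divides-sound xs g hxs
      with root ← root-timesAll α xs (toList u) α∉
                    (trans (cong (horner (- α) 1#) (trans eq (sym eqα))) (root-times α (toList w)))
      with toList u
    -- An empty coefficient list stands for the constant 1, which has no root.
    ... | []    = contradiction (sym root) 0≢1
    ... | y ∷ v with v′ , eqv ← factor-theorem α 1# y v root =
      divides-complete (α ∷ xs) g v′ (trans (sym (timesAll-times xs α v′)) (trans (cong (timesAll xs) eqv) eq))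

  divides-all : ∀ {xs d} (g : Vec Carrier d) → Unique xs → divides xs g ≡ all (λ α → divides [ α ] g) xs
  divides-all g []       = T-ext _ (λ _ → divides-complete [] g (toList g) refl)
  divides-all g (α∉ ∷ u) = trans (divides-∷ _ _ g α∉) (cong (_ ∧_) (divides-all g u))

  -- Counting multiples with prescribed leading coefficients.

  agrees : (ℓ : ℕ) → ∀ {d} → Vec Carrier d → List Carrier → Bool
  agrees ℓ f w = ⌊ VP.≡-dec _≟_ (takePad ℓ w) (takePad ℓ (toList f)) ⌋

  sim-monic : ∀ ℓ {d} (f : Vec Carrier d) w → sim ℓ (reverse (1# ∷ w)) (monic f) ≡ agrees ℓ f w
  sim-monic ℓ f w = cong₂ (λ a b → ⌊ VP.≡-dec _≟_ a b ⌋) (leading-monic ℓ w) (leading-monic ℓ (toList f))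

  sim-mulP : ∀ ℓ {d} (f : Vec Carrier d) xs u → sim ℓ (mulP (reverse (1# ∷ u)) (prodLin xs)) (monic f) ≡ agrees ℓ f (timesAll xs u)
  sim-mulP ℓ f xs u = trans (cong (λ p → sim ℓ p (monic f)) (mulP-prodLin u xs)) (sim-monic ℓ f (timesAll xs u))

  count-multiples : ∀ ℓ {d d′} (f : Vec Carrier d′) xs → length xs ≤ d →
    count (allVecs elements d) (λ g → sim ℓ (monic g) (monic f) ∧ divides xs g)
    ≡ count (allVecs elements (d ∸ length xs)) (λ u → sim ℓ (mulP (monic u) (prodLin xs)) (monic f))
  count-multiples ℓ {d} f xs ≤d = count-bijection
    (allVecs-unique elements-unique d) (allVecs-unique elements-unique (d ∸ length xs))
    (allVecs-complete elements-complete) (allVecs-complete elements-complete)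
    toList (timesAll xs ∘ toList) toList-inj (toList-inj ∘ timesAll-injective xs) to from
    where
    to : ∀ g → T (sim ℓ (monic g) (monic f) ∧ divides xs g) →
         ∃ λ u → T (sim ℓ (mulP (monic u) (prodLin xs)) (monic f)) × toList g ≡ timesAll xs (toList u)
    to g h with s , dv ← Equivalence.to (T-∧ {sim ℓ (monic g) (monic f)}) h
      with _ , u , eq ← divides-sound xs g dv
      = u , subst T (trans (sim-monic ℓ f (toList g)) (trans (cong (agrees ℓ f) (sym eq)) (sym (sim-mulP ℓ f xs (toList u))))) s , sym eq
    from : ∀ u → T (sim ℓ (mulP (monic u) (prodLin xs)) (monic f)) →
           ∃ λ g → T (sim ℓ (monic g) (monic f) ∧ divides xs g) × toList g ≡ timesAll xs (toList u)
    from u h with g , eq ← toVec (timesAll xs (toList u))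
                             (trans (length-timesAll xs (toList u)) (trans (cong (length xs ℕ.+_) (VP.length-toList u)) (ℕₚ.m+[n∸m]≡n ≤d)))
      = g , Equivalence.from T-∧
              ( subst T (trans (sim-mulP ℓ f xs (toList u)) (trans (cong (agrees ℓ f) (sym eq)) (sym (sim-monic ℓ f (toList g))))) h
              , divides-complete xs g (toList u) (sym eq) ) , eq

  count-multiples-zero : ∀ ℓ {d d′} (f : Vec Carrier d′) xs → ¬ (length xs ≤ d) →
    count (allVecs elements d) (λ g → sim ℓ (monic g) (monic f) ∧ divides xs g) ≡ 0
  count-multiples-zero ℓ {d} f xs ≰d = begin
    count (allVecs elements d) (λ g → sim ℓ (monic g) (monic f) ∧ divides xs g)
      ≡⟨ count-cong (allVecs elements d) (λ g → T-ext (λ h → ≰d (proj₁ (divides-sound xs g (proj₂ (Equivalence.to (T-∧ {sim ℓ (monic g) (monic f)}) h))))) ⊥-elim) ⟩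
    count (allVecs elements d) (λ _ → false)  ≡⟨ count≡∑ (allVecs elements d) (λ _ → false) ⟩
    ∑ (allVecs elements d) (λ _ → 0)          ≡⟨ ∑-zero (allVecs elements d) ⟩
    0                                         ∎
    where open ≡-Reasoning

  -- Inverts `times` on leading coefficients; c * - α + y is the Horner step of division by x + α.
  untimes : ∀ {ℓ} → Carrier → Carrier → Vec Carrier ℓ → Vec Carrier ℓ
  untimes α c []      = []
  untimes α c (y ∷ t) = (c * - α + y) ∷ untimes α (c * - α + y) t

  untimesAll : ∀ {ℓ} → List Carrier → Vec Carrier ℓ → Vec Carrier ℓ
  untimesAll []       t = t
  untimesAll (α ∷ xs) t = untimesAll xs (untimes α 1# t)

  -- Entry i of the product involves only entries i and i - 1 of `v`, with coefficient 1 at entry i: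
  -- a unitriangular system, which can be truncated after ℓ entries and solved from the top.
  untimes-times : ∀ ℓ α c v → ℓ ≤ length v → untimes α c (takePad ℓ (times α c v)) ≡ takePad ℓ v
  untimes-times zero    α c v       _       = refl
  untimes-times (suc ℓ) α c (x ∷ v) (s≤s h) = trans (cong (λ z → z ∷ untimes α z (takePad ℓ (times α x v))) undo)
                                                    (cong (x ∷_) (untimes-times ℓ α x v h))
    where
    undo : c * - α + (x + α * c) ≡ x
    undo = trans (sym (+-assoc (c * - α) x (α * c))) (divide-coeff α c x)

  untimes-injective : ∀ {ℓ} α c {s t : Vec Carrier ℓ} → untimes α c s ≡ untimes α c t → s ≡ t
  untimes-injective α c {[]}    {[]}    _  = refl
  untimes-injective α c {x ∷ s} {y ∷ t} eq
    with refl ← +-cancelˡ (c * - α) x y (VP.∷-injectiveˡ eq) = cong (x ∷_) (untimes-injective α _ (VP.∷-injectiveʳ eq))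

  untimesAll-to : ∀ ℓ xs u (t : Vec Carrier ℓ) → ℓ ≤ length u →
                  takePad ℓ (timesAll xs u) ≡ t → takePad ℓ u ≡ untimesAll xs t
  untimesAll-to ℓ []       u t h eq = eq
  untimesAll-to ℓ (α ∷ xs) u t h eq = untimesAll-to ℓ xs u _ h
    (trans (sym (untimes-times ℓ α 1# (timesAll xs u) (≤-timesAll xs h))) (cong (untimes α 1#) eq))

  -- That `untimes` undoes `times` gives only the other direction; here its injectivity shows that
  -- every prescribed `t` is attained.
  untimesAll-from : ∀ ℓ xs u (t : Vec Carrier ℓ) → ℓ ≤ length u →
                    takePad ℓ u ≡ untimesAll xs t → takePad ℓ (timesAll xs u) ≡ t
  untimesAll-from ℓ []       u t h eq = eq
  untimesAll-from ℓ (α ∷ xs) u t h eq = untimes-injective α 1#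
    (trans (untimes-times ℓ α 1# (timesAll xs u) (≤-timesAll xs h)) (untimesAll-from ℓ xs u _ h eq))

  takePad-++ : ∀ {ℓ} (t : Vec Carrier ℓ) w → takePad ℓ (toList t ++ w) ≡ t
  takePad-++ []      w = refl
  takePad-++ (x ∷ t) w = cong (x ∷_) (takePad-++ t w)

  takePad-split : ∀ ℓ {e} (u : Vec Carrier (ℓ ℕ.+ e)) → ∃ λ (w : Vec Carrier e) → toList u ≡ toList (takePad ℓ (toList u)) ++ toList w
  takePad-split zero    u       = u , refl
  takePad-split (suc ℓ) (x ∷ u) with w , eq ← takePad-split ℓ u = w , cong (x ∷_) eq

  count-prescribed : ∀ ℓ {d e d′} (f : Vec Carrier d′) xs → d ≡ ℓ ℕ.+ e →
    count (allVecs elements d) (λ u → sim ℓ (mulP (monic u) (prodLin xs)) (monic f)) ≡ order ^ e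
  count-prescribed ℓ {e = e} f xs refl = begin
    count (allVecs elements (ℓ ℕ.+ e)) (λ u → sim ℓ (mulP (monic u) (prodLin xs)) (monic f))
      ≡⟨ count-bijection {q = λ _ → true} (allVecs-unique elements-unique (ℓ ℕ.+ e)) (allVecs-unique elements-unique e)
           (allVecs-complete elements-complete) (allVecs-complete elements-complete)
           toList (λ w → toList t ++ toList w) toList-inj (toList-inj ∘ LP.++-cancelˡ (toList t) _ _) to from ⟩
    count (allVecs elements e) (λ _ → true)  ≡⟨ count-true (allVecs elements e) ⟩
    length (allVecs elements e)              ≡⟨ length-allVecs elements e ⟩
    order ^ e                                ∎
    where
    open ≡-Reasoning
    -- The leading coefficients that the cofactor must have for the product to agree with f; its
    -- other e coefficients are free.
    t = untimesAll xs (takePad ℓ (toList f))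
    ℓ≤ : ∀ (u : Vec Carrier (ℓ ℕ.+ e)) → ℓ ≤ length (toList u)
    ℓ≤ u = subst (ℓ ≤_) (sym (VP.length-toList u)) (ℕₚ.m≤m+n ℓ e)
    to : ∀ u → T (sim ℓ (mulP (monic u) (prodLin xs)) (monic f)) → ∃ λ w → T true × toList u ≡ toList t ++ toList w
    to u h with w , eq ← takePad-split ℓ u = w , _ , trans eq (cong (λ s → toList s ++ toList w)
      (untimesAll-to ℓ xs (toList u) _ (ℓ≤ u) (toWitness (subst T (sim-mulP ℓ f xs (toList u)) h))))
    from : ∀ w → T true → ∃ λ u → T (sim ℓ (mulP (monic u) (prodLin xs)) (monic f)) × toList u ≡ toList t ++ toList w
    from w _ = t Vec.++ w , subst T (sym (sim-mulP ℓ f xs (toList (t Vec.++ w)))) (fromWitness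
      (untimesAll-from ℓ xs _ _ (ℓ≤ (t Vec.++ w)) (trans (cong (takePad ℓ) (VP.toList-++ t w)) (takePad-++ t (toList w))))) , VP.toList-++ t w

-- The quantities M(f, r) and N(f, r).

module Moments (𝔽 : FiniteField) {n : ℕ} (D : Fin n → FiniteField.Carrier 𝔽) (D-injective : Injective _≡_ _≡_ D)
               (ℓ k : ℕ) (f : Vec (FiniteField.Carrier 𝔽) (k ℕ.+ ℓ)) where
  open FiniteField 𝔽 using (Carrier; elements; order)
  open Poly 𝔽
  open WithD D
  open Polynomials 𝔽
  open ℚ-Solver.+-*-Solver using (solve; _:+_; _:*_; _:=_; con)
  open import Algebra.Properties.CommutativeSemigroup ℕₚ.*-commutativeSemigroup using (x∙yz≈y∙xz)

  private
    polys : List (Vec Carrier (k ℕ.+ ℓ))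
    polys = allVecs elements (k ℕ.+ ℓ)

    multiples : List Carrier → ℕ
    multiples xs = count polys (λ g → sim ℓ (monic g) (monic f) ∧ divides xs g)

    cofactors : ℕ → List Carrier → ℕ
    cofactors a xs = count (allVecs elements a) (λ u → sim ℓ (mulP (monic u) (prodLin xs)) (monic f))

  M≡∑ : ∀ r → M ℓ f r ≡ ∑ (𝒫 n) (λ S → ⟦ ⌊ length (indices S) ℕ.≟ r ⌋ ⟧ ℕ.* multiples (members S))
  M≡∑ r = trans (∑-filterᵇ (λ S → ⌊ length (members S) ℕ.≟ r ⌋) (𝒫 n))
    (∑-cong (𝒫 n) (λ S → cong (λ l → ⟦ ⌊ l ℕ.≟ r ⌋ ⟧ ℕ.* multiples (members S)) (length-map D (indices S))))

  M-cong : ∀ r (F : List (Fin n) → ℕ) → (∀ is → length is ≡ r → multiples (map D is) ≡ F is) →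
           M ℓ f r ≡ ∑ (𝒫 n) (λ S → ⟦ ⌊ length (indices S) ℕ.≟ r ⌋ ⟧ ℕ.* F (indices S))
  M-cong r F eq = trans (M≡∑ r)
    (∑-cong (𝒫 n) (λ S → ⟦⌊⌋⟧*-cong (length (indices S) ℕ.≟ r) (eq (indices S))))

  multiples≡cofactors : ∀ r → r ≤ k ℕ.+ ℓ → ∀ is → length is ≡ r →
                        multiples (map D is) ≡ cofactors (k ℕ.+ ℓ ∸ r) (map D is)
  multiples≡cofactors r r≤ is refl =
    trans (count-multiples ℓ f (map D is) (subst (_≤ k ℕ.+ ℓ) (sym (length-map D is)) r≤))
          (cong (λ l → cofactors (k ℕ.+ ℓ ∸ l) (map D is)) (length-map D is))

  M-small : ∀ r → r ≤ k → M ℓ f r ≡ order ^ (k ∸ r) ℕ.* (n C r)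
  M-small r r≤k = begin
    M ℓ f r
      ≡⟨ M-cong r (λ _ → order ^ (k ∸ r)) (λ is eq →
           trans (multiples≡cofactors r (ℕₚ.≤-trans r≤k (ℕₚ.m≤m+n k ℓ)) is eq)
                 (count-prescribed ℓ f (map D is) degree)) ⟩
    ∑ (𝒫 n) (λ S → ⟦ ⌊ length (indices S) ℕ.≟ r ⌋ ⟧ ℕ.* order ^ (k ∸ r))
      ≡⟨ ∑-*ʳ (𝒫 n) (order ^ (k ∸ r)) ⟩
    ∑ (𝒫 n) (λ S → ⟦ ⌊ length (indices S) ℕ.≟ r ⌋ ⟧) ℕ.* order ^ (k ∸ r)
      ≡⟨ cong (ℕ._* order ^ (k ∸ r)) (∑-subsets-of-size n r) ⟩
    (n C r) ℕ.* order ^ (k ∸ r)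
      ≡⟨ ℕₚ.*-comm (n C r) _ ⟩
    order ^ (k ∸ r) ℕ.* (n C r) ∎
    where
    open ≡-Reasoning
    degree : k ℕ.+ ℓ ∸ r ≡ ℓ ℕ.+ (k ∸ r)
    degree = trans (cong (_∸ r) (ℕₚ.+-comm k ℓ)) (ℕₚ.+-∸-assoc ℓ r≤k)

  M-large : ∀ r → k ℕ.+ ℓ < r → M ℓ f r ≡ 0
  M-large r k+ℓ<r = begin
    M ℓ f r
      ≡⟨ M-cong r (λ _ → 0) (λ { is refl → count-multiples-zero ℓ f (map D is)
           (ℕₚ.<⇒≱ (subst (k ℕ.+ ℓ <_) (sym (length-map D is)) k+ℓ<r)) }) ⟩
    ∑ (𝒫 n) (λ S → ⟦ ⌊ length (indices S) ℕ.≟ r ⌋ ⟧ ℕ.* 0)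
      ≡⟨ ∑-cong (𝒫 n) (λ S → ℕₚ.*-zeroʳ ⟦ ⌊ length (indices S) ℕ.≟ r ⌋ ⟧) ⟩
    ∑ (𝒫 n) (λ _ → 0)
      ≡⟨ ∑-zero (𝒫 n) ⟩
    0 ∎
    where open ≡-Reasoning

  cofactors-↭ : ∀ a {xs ys} → xs ↭ ys → cofactors a xs ≡ cofactors a ys
  cofactors-↭ a {xs} {ys} xs↭ys = count-cong (allVecs elements a) (λ u →
    trans (sim-mulP ℓ f xs (toList u)) (trans (cong (agrees ℓ f) (timesAll-↭ (toList u) xs↭ys)) (sym (sim-mulP ℓ f ys (toList u)))))

  T≡r!*M : ∀ r → r ≤ k ℕ.+ ℓ → T ℓ f (k ℕ.+ ℓ ∸ r) r ≡ r ! ℕ.* M ℓ f r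
  T≡r!*M r r≤ = begin
    T ℓ f a r
      ≡⟨ ∑-map (Vec.map D) (filterᵇ distinct tuples) ⟩
    ∑ (filterᵇ distinct tuples) (λ v → cofactors a (toList (Vec.map D v)))
      ≡⟨ ∑-filterᵇ distinct tuples ⟩
    ∑ tuples (λ v → ⟦ distinct v ⟧ ℕ.* cofactors a (toList (Vec.map D v)))
      ≡⟨ ∑-cong tuples (λ v → cong (λ xs → ⟦ distinct v ⟧ ℕ.* cofactors a xs) (VP.toList-map D v)) ⟩
    ∑ tuples (λ v → ⟦ distinct v ⟧ ℕ.* cofactors a (map D (toList v)))
      -- Reordering the linear factors does not change their product, so the count of cofactors
      -- depends on the underlying subset only.
      ≡⟨ ∑-distinct-tuples (λ is → cofactors a (map D is)) (λ v↭w → cofactors-↭ a (PermP.map⁺ D v↭w)) r ⟩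
    r ! ℕ.* ∑ (𝒫 n) (λ S → ⟦ ⌊ length (indices S) ℕ.≟ r ⌋ ⟧ ℕ.* cofactors a (map D (indices S)))
      ≡⟨ cong (r ! ℕ.*_) (M-cong r (λ is → cofactors a (map D is)) (multiples≡cofactors r r≤)) ⟨
    r ! ℕ.* M ℓ f r ∎
    where
    open ≡-Reasoning
    a = k ℕ.+ ℓ ∸ r
    tuples = allVecs (allFin n) r
    distinct = λ (v : Vec (Fin n) r) → ⌊ UDec.unique? Fin._≟_ (toList v) ⌋

  M-middle : ∀ r → r ≤ k ℕ.+ ℓ → ι (M ℓ f r) ≡ inv (r !) ℚ.* ι (T ℓ f (k ℕ.+ ℓ ∸ r) r)
  M-middle r r≤ = begin
    ι (M ℓ f r)                                  ≡⟨ ℚₚ.*-identityˡ (ι (M ℓ f r)) ⟨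
    1ℚ ℚ.* ι (M ℓ f r)                           ≡⟨ cong (ℚ._* ι (M ℓ f r)) (inv-*-ι (r !) {{r ℕₚ.!≢0}}) ⟨
    inv (r !) ℚ.* ι (r !) ℚ.* ι (M ℓ f r)        ≡⟨ ℚₚ.*-assoc (inv (r !)) (ι (r !)) (ι (M ℓ f r)) ⟩
    inv (r !) ℚ.* (ι (r !) ℚ.* ι (M ℓ f r))      ≡⟨ cong (inv (r !) ℚ.*_) (trans (cong ι (T≡r!*M r r≤)) (ι-* (r !) (M ℓ f r))) ⟨
    inv (r !) ℚ.* ι (T ℓ f (k ℕ.+ ℓ ∸ r) r)      ∎
    where open ≡-Reasoning

  divides-members : ∀ {d} (g : Vec Carrier d) {is} → Unique is → divides (map D is) g ≡ all (λ i → divides [ D i ] g) is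
  divides-members g {is} u = trans (divides-all g (UP.map⁺ D-injective u)) (all-map (λ α → divides [ α ] g) D is)

  -- Both sides count the pairs (S, g) with |S| = j and S a set of roots of g.
  M-moment : ∀ j → M ℓ f j ≡ ∑ polys (λ g → ⟦ sim ℓ (monic g) (monic f) ⟧ ℕ.* (nRoots g C j))
  M-moment j = begin
    M ℓ f j
      ≡⟨ M≡∑ j ⟩
    ∑ (𝒫 n) (λ S → size S ℕ.* multiples (members S))
      ≡⟨ ∑-cong (𝒫 n) (λ S → trans (cong (size S ℕ.*_) (count≡∑ polys _)) (sym (∑-*ˡ polys (size S)))) ⟩
    ∑ (𝒫 n) (λ S → ∑ polys (λ g → size S ℕ.* ⟦ sim ℓ (monic g) (monic f) ∧ divides (members S) g ⟧))
      ≡⟨ ∑-swap (𝒫 n) polys ⟩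
    ∑ polys (λ g → ∑ (𝒫 n) (λ S → size S ℕ.* ⟦ sim ℓ (monic g) (monic f) ∧ divides (members S) g ⟧))
      ≡⟨ ∑-cong polys (λ g → trans (∑-cong (𝒫 n) (λ S → separate g S))
           (trans (∑-*ˡ (𝒫 n) ⟦ sim ℓ (monic g) (monic f) ⟧)
                  (cong (⟦ sim ℓ (monic g) (monic f) ⟧ ℕ.*_) (∑-subsets-of (λ i → divides [ D i ] g) j)))) ⟩
    ∑ polys (λ g → ⟦ sim ℓ (monic g) (monic f) ⟧ ℕ.* (nRoots g C j)) ∎
    where
    open ≡-Reasoning
    size : Vec _ n → ℕ
    size S = ⟦ ⌊ length (indices S) ℕ.≟ j ⌋ ⟧
    separate : ∀ g S → size S ℕ.* ⟦ sim ℓ (monic g) (monic f) ∧ divides (members S) g ⟧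
                       ≡ ⟦ sim ℓ (monic g) (monic f) ⟧ ℕ.* (size S ℕ.* ⟦ all (λ i → divides [ D i ] g) (indices S) ⟧)
    separate g S = begin
      size S ℕ.* ⟦ sim ℓ (monic g) (monic f) ∧ divides (members S) g ⟧
        ≡⟨ cong (size S ℕ.*_) (⟦∧⟧ (sim ℓ (monic g) (monic f)) (divides (members S) g)) ⟩
      size S ℕ.* (⟦ sim ℓ (monic g) (monic f) ⟧ ℕ.* ⟦ divides (members S) g ⟧)
        ≡⟨ x∙yz≈y∙xz (size S) ⟦ sim ℓ (monic g) (monic f) ⟧ ⟦ divides (members S) g ⟧ ⟩
      ⟦ sim ℓ (monic g) (monic f) ⟧ ℕ.* (size S ℕ.* ⟦ divides (members S) g ⟧)
        ≡⟨ cong (λ b → ⟦ sim ℓ (monic g) (monic f) ⟧ ℕ.* (size S ℕ.* ⟦ b ⟧)) (divides-members g (indices-unique S)) ⟩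
      ⟦ sim ℓ (monic g) (monic f) ⟧ ℕ.* (size S ℕ.* ⟦ all (λ i → divides [ D i ] g) (indices S) ⟧) ∎

  -- By `divides-members` the product over all roots found in D divides g, and a divisor has at most
  -- the degree of g.
  nRoots≤degree : ∀ {d} (g : Vec Carrier d) → nRoots g ≤ d
  nRoots≤degree {d} g = subst (_≤ d) (length-map D roots)
    (proj₁ (divides-sound (map D roots) g (subst 𝔹.T (sym (divides-members g (UP.filter⁺ (T? ∘ isRoot) (UP.allFin⁺ n))))
      (all⁻ isRoot (all-filter (T? ∘ isRoot) (allFin n))))))
    where
    isRoot = λ i → divides [ D i ] g
    roots = filterᵇ isRoot (allFin n)

  N-from-M : ∀ r → ι (N ℓ f r) ≡ sumTo (λ j → signedC j r ℚ.* ι (M ℓ f j)) (suc k ℕ.+ ℓ)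
  N-from-M r = begin
    ι (N ℓ f r)
      ≡⟨ cong ι (trans (count≡∑ polys _) (∑-cong polys (λ g → ⟦∧⟧ (sim ℓ (monic g) (monic f)) _))) ⟩
    ι (∑ polys (λ g → ⟦ sim ℓ (monic g) (monic f) ⟧ ℕ.* ⟦ ⌊ nRoots g ℕ.≟ r ⌋ ⟧))
      ≡⟨ exactly-from-moments polys (λ g → ⟦ sim ℓ (monic g) (monic f) ⟧) nRoots r (suc k ℕ.+ ℓ) (λ g → s≤s (nRoots≤degree g)) ⟩
    sumTo (λ j → signedC j r ℚ.* ι (∑ polys (λ g → ⟦ sim ℓ (monic g) (monic f) ⟧ ℕ.* (nRoots g C j)))) (suc k ℕ.+ ℓ)
      ≡⟨ sumTo-cong (suc k ℕ.+ ℓ) (λ j _ → cong (λ m → signedC j r ℚ.* ι m) (sym (M-moment j))) ⟩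
    sumTo (λ j → signedC j r ℚ.* ι (M ℓ f j)) (suc k ℕ.+ ℓ) ∎
    where open ≡-Reasoning

  ιM-small : ∀ r → r ≤ k → ι (M ℓ f r) ≡ (ι order ^ℚ (k ∸ r)) ℚ.* ι (n C r)
  ιM-small r r≤k = trans (cong ι (M-small r r≤k))
    (trans (ι-* (order ^ (k ∸ r)) (n C r)) (cong (ℚ._* ι (n C r)) (ι-^ order (k ∸ r))))

  M-formula : ∀ r → ι (M ℓ f r) ≡
    𝟙 (r ≤? k) ℚ.* (ι order ^ℚ (k ∸ r)) ℚ.* ι (n C r)
    ℚ.+ 𝟙 (k <? r) ℚ.* 𝟙 (r ≤? k ℕ.+ ℓ) ℚ.* inv (r !) ℚ.* ι (T ℓ f (k ℕ.+ ℓ ∸ r) r)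
  M-formula r = cases (r ≤? k) (k <? r) (r ≤? k ℕ.+ ℓ)
    where
    Q B I X : ℚ
    Q = ι order ^ℚ (k ∸ r)
    B = ι (n C r)
    I = inv (r !)
    X = ι (T ℓ f (k ℕ.+ ℓ ∸ r) r)
    -- The three decisions are arguments, so that matching on them makes each `𝟙` compute.
    cases : (a : Dec (r ≤ k)) (b : Dec (k < r)) (c : Dec (r ≤ k ℕ.+ ℓ)) → ι (M ℓ f r) ≡ 𝟙 a ℚ.* Q ℚ.* B ℚ.+ 𝟙 b ℚ.* 𝟙 c ℚ.* I ℚ.* X
    cases (yes r≤k) (yes k<r) _        = contradiction r≤k (ℕₚ.<⇒≱ k<r)
    cases (no r≰k)  (no k≮r)  _        = contradiction (ℕₚ.≰⇒> r≰k) k≮r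
    cases (yes r≤k) (no _)    c        = trans (ιM-small r r≤k)
      (solve 5 (λ q c d i x → q :* c := con 1ℚ :* q :* c :+ con 0ℚ :* d :* i :* x) refl Q B (𝟙 c) I X)
    cases (no _)    (yes _)   (yes r≤) = trans (M-middle r r≤)
      (solve 4 (λ q c i x → i :* x := con 0ℚ :* q :* c :+ con 1ℚ :* con 1ℚ :* i :* x) refl Q B I X)
    cases (no _)    (yes _)   (no r≰)  = trans (cong ι (M-large r (ℕₚ.≰⇒> r≰)))
      (solve 4 (λ q c i x → con 0ℚ := con 0ℚ :* q :* c :+ con 1ℚ :* con 0ℚ :* i :* x) refl Q B I X)

  order-nonZero : ℕ.NonZero order
  order-nonZero = ℕ.>-nonZero (∈-length (FiniteField.elements-complete 𝔽 (FiniteField.0# 𝔽)))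

  N-formula : ∀ r → ι (N ℓ f r) ≡
    (ι order ^ℚ (k ∸ r)) ℚ.* ι (n C r)
      ℚ.* sumℚ (map (λ j → ((ℚ.- inv order) ^ℚ j) ℚ.* ι ((n ∸ r) C j)) (upTo (suc k ∸ r)))
    ℚ.+ sumℚ (map (λ i → ((ℚ.- ι 1) ^ℚ (k ℕ.+ i ∸ r)) ℚ.* ι ((k ℕ.+ i) C r)
                           ℚ.* inv ((k ℕ.+ i) !) ℚ.* ι (T ℓ f (ℓ ∸ i) (k ℕ.+ i)))
                  (map suc (upTo ℓ)))
  N-formula r = begin
    ι (N ℓ f r)
      ≡⟨ N-from-M r ⟩
    sumTo (λ j → signedC j r ℚ.* ι (M ℓ f j)) (suc k ℕ.+ ℓ)
      -- The moments with j ≤ k have a closed form; the remaining ℓ of them, j = k + 1, ..., k + ℓ,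
      -- are left as counts of tuples.
      ≡⟨ sumTo-split (λ j → signedC j r ℚ.* ι (M ℓ f j)) (suc k) ℓ ⟩
    sumTo (λ j → signedC j r ℚ.* ι (M ℓ f j)) (suc k) ℚ.+ sumTo (λ i → signedC (suc k ℕ.+ i) r ℚ.* ι (M ℓ f (suc k ℕ.+ i))) ℓ
      ≡⟨ cong₂ ℚ._+_ (trans (sumTo-cong (suc k) (λ j j<1+k → cong (signedC j r ℚ.*_) (ιM-small j (ℕ.s≤s⁻¹ j<1+k))))
                            (main-term order {{order-nonZero}} n k r))
                     (sumTo-cong ℓ term) ⟩
    c ℚ.* sumTo u (suc k ∸ r) ℚ.+ sumTo (v ∘ suc) ℓ
      ≡⟨ cong₂ (λ xs ys → c ℚ.* sumℚ xs ℚ.+ sumℚ ys) (map-upTo u (suc k ∸ r))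
               (trans (sym (map-∘ (upTo ℓ))) (map-upTo (v ∘ suc) ℓ)) ⟨
    c ℚ.* sumℚ (map u (upTo (suc k ∸ r))) ℚ.+ sumℚ (map v (map suc (upTo ℓ))) ∎
    where
    open ≡-Reasoning
    c = (ι order ^ℚ (k ∸ r)) ℚ.* ι (n C r)
    u v : ℕ → ℚ
    u j = ((ℚ.- inv order) ^ℚ j) ℚ.* ι ((n ∸ r) C j)
    v i = ((ℚ.- ι 1) ^ℚ (k ℕ.+ i ∸ r)) ℚ.* ι ((k ℕ.+ i) C r) ℚ.* inv ((k ℕ.+ i) !) ℚ.* ι (T ℓ f (ℓ ∸ i) (k ℕ.+ i))
    -- Here i starts at 0, while the sum in the formula starts at 1; hence `v (suc i)` and j = k +
    -- (i + 1), for which the cofactors have degree ℓ - (i + 1).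
    term : ∀ i → i < ℓ → signedC (suc k ℕ.+ i) r ℚ.* ι (M ℓ f (suc k ℕ.+ i)) ≡ v (suc i)
    term i i<ℓ = begin
      signedC (suc k ℕ.+ i) r ℚ.* ι (M ℓ f (suc k ℕ.+ i))
        ≡⟨ cong (λ j → signedC j r ℚ.* ι (M ℓ f j)) (ℕₚ.+-suc k i) ⟨
      signedC j r ℚ.* ι (M ℓ f j)
        ≡⟨ cong (signedC j r ℚ.*_) (M-middle j (ℕₚ.+-monoʳ-≤ k i<ℓ)) ⟩
      signedC j r ℚ.* (inv (j !) ℚ.* ι (T ℓ f (k ℕ.+ ℓ ∸ j) j))
        ≡⟨ cong (λ a → signedC j r ℚ.* (inv (j !) ℚ.* ι (T ℓ f a j))) (ℕₚ.[m+n]∸[m+o]≡n∸o k ℓ (suc i)) ⟩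
      signedC j r ℚ.* (inv (j !) ℚ.* ι (T ℓ f (ℓ ∸ suc i) j))
        ≡⟨ ℚₚ.*-assoc (signedC j r) (inv (j !)) (ι (T ℓ f (ℓ ∸ suc i) j)) ⟨
      v (suc i) ∎
      where j = k ℕ.+ suc i

theorem1 :
    (𝔽 : FiniteField) →
    let open FiniteField 𝔽
        q = order
    in
    (n : ℕ) (D : Fin n → Carrier) → Injective _≡_ _≡_ D →
    (ℓ k : ℕ) → 1 ≤ ℓ → (f : Vec Carrier (k ℕ.+ ℓ)) → (r : ℕ) →
    let open Poly 𝔽
        open WithD D
    in
      (ι (M ℓ f r) ≡
         𝟙 (r ≤? k) ℚ.* (ι q ^ℚ (k ∸ r)) ℚ.* ι (n C r)
         ℚ.+ 𝟙 (k <? r) ℚ.* 𝟙 (r ≤? k ℕ.+ ℓ) ℚ.* inv (r !)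
             ℚ.* ι (T ℓ f (k ℕ.+ ℓ ∸ r) r))
    × (ι (N ℓ f r) ≡
         (ι q ^ℚ (k ∸ r)) ℚ.* ι (n C r)
           ℚ.* sumℚ (List.map (λ j → ((ℚ.- inv q) ^ℚ j) ℚ.* ι ((n ∸ r) C j))
                              (List.upTo (suc k ∸ r)))
         ℚ.+ sumℚ (List.map (λ i →
                ((ℚ.- ι 1) ^ℚ (k ℕ.+ i ∸ r)) ℚ.* ι ((k ℕ.+ i) C r)
                  ℚ.* inv ((k ℕ.+ i) !) ℚ.* ι (T ℓ f (ℓ ∸ i) (k ℕ.+ i)))
              (List.map suc (List.upTo ℓ))))
theorem1 𝔽 n D D-injective ℓ k _ f r = M-formula r , N-formula r
  where open Moments 𝔽 D D-injective ℓ k f
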